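{- The reinforcement problem is NP-hard even when restricted to bipartite graphs and $k=1$. That is, the following decision problem is NP-hard: given a finite simple bipartite graph $G$, decide whether $r(G)\le 1$, where $r(G)$ is the reinforcement number of $G$.
   Context: All graphs are finite, undirected and simple. A dominating set of a graph $G=(V,E)$ is a set $D\subseteq V$ such that every vertex of $V\setminus D$ has at least one neighbor in $D$; the domination number $\gamma(G)$ is the minimum cardinality of a dominating set of $G$. The reinforcement number $r(G)$ is the smallest number of edges of the complement $\bar G$ whose addition to $G$ results in a graph with domination number smaller than $\gamma(G)$; if no such set of edges exists (i.e. if $\gamma(G)=1$), then $r(G)=\infty$ (so $r(G)\le k$ fails). The graph obtained by adding edges is not required to be bipartite. Reinforcement problem. Instance: a graph $G$ and a positive integer $k$. Question: is $r(G)\le k$? NP-hardness is meant with respect to polynomial-time many-one reductions (polynomial transformations): a decision problem is NP-hard if some NP-complete problem, such as 3SAT (equivalently, every problem in NP), reduces to it in polynomial time. (3SAT: given a collection of clauses, each consisting of three literals over a finite set of Boolean variables, decide whether some truth assignment satisfies all the clauses.) -}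

module Defs where

open import Data.Bool.Base using (Bool; true; false)
open import Data.Fin.Base using (Fin; toℕ) renaming (_<_ to _<ᶠ_)
open import Data.Fin.Subset using (Subset; _∈_; _∉_; ∣_∣)
open import Data.List.Base using (List; []; _∷_; _++_; length; map; replicate)
import Data.List.Membership.Propositional as List
open import Data.List.Relation.Unary.All using (All)
open import Data.List.Relation.Unary.All.Properties using (++⁺)
open import Data.List.Relation.Unary.Unique.Propositional using (Unique)
open import Data.Maybe.Base as Maybe using (Maybe; just; nothing)
open import Data.Nat.Base using (ℕ; suc; _+_; _*_; _^_; _≤_; _<_)
open import Data.Product.Base using (Σ; ∃-syntax; _×_; _,_; uncurry)
open import Data.Sum.Base using (_⊎_)
open import Data.Vec.Base as Vec using (Vec; []; _∷_; zipWith)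
open import Data.Vec.Relation.Unary.Any using (Any)
open import Function.Bundles using (_⇔_; _↔_)
open import Relation.Binary.Construct.Add.Supremum.NonStrict _≤_ using (_≤⁺_)
open import Relation.Binary.PropositionalEquality using (_≡_; _≢_)
open import Relation.Nullary.Construct.Add.Supremum using (_⁺; [_]; ⊤⁺)
open import Relation.Nullary.Negation using (¬_)

-- The vertex set is Fin n.  The undirected edge {u,v} is written (u , v)
-- with u < v, which rules out loops.  The list presents a set of edges:
-- adjacency does not depend on the order or multiplicity of its entries.
record Graph : Set where
  constructor mkGraph
  field
    n       : ℕ
    edges   : List (Fin n × Fin n)
    ordered : All (uncurry _<ᶠ_) edges

open Graph public

Adj : (G : Graph) → Fin (n G) → Fin (n G) → Set
Adj G u v = ((u , v) List.∈ edges G) ⊎ ((v , u) List.∈ edges G)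

Bipartite : Graph → Set
Bipartite G =
  Σ (Fin (n G) → Bool) λ side → ∀ u v → Adj G u v → side u ≢ side v

Dominating : (G : Graph) → Subset (n G) → Set
Dominating G D = ∀ v → v ∉ D → ∃[ u ] (u ∈ D × Adj G v u)

IsLeast : (ℕ → Set) → ℕ → Set
IsLeast P m = P m × (∀ j → P j → m ≤ j)

-- d = γ(G)
IsDominationNumber : Graph → ℕ → Set
IsDominationNumber G =
  IsLeast (λ d → ∃[ D ] (Dominating G D × ∣ D ∣ ≡ d))

addEdges : (G : Graph) (F : List (Fin (n G) × Fin (n G))) →
           All (uncurry _<ᶠ_) F → Graph
addEdges G F F-ordered = mkGraph (n G) (F ++ edges G) (++⁺ F-ordered (ordered G))

-- F is a set of edges of the complement of G with γ(G + F) < γ(G); by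
-- F-distinct, its cardinality is length F.
record Reinforcing (G : Graph) (F : List (Fin (n G) × Fin (n G))) : Set where
  field
    F-ordered  : All (uncurry _<ᶠ_) F
    F-distinct : Unique F
    F-new      : All (λ (u , v) → ¬ Adj G u v) F
    γ-old γ-new : ℕ
    is-γ-old   : IsDominationNumber G γ-old
    is-γ-new   : IsDominationNumber (addEdges G F F-ordered) γ-new
    decreases  : γ-new < γ-old

-- r = r(G), a natural number or infinity.
IsReinforcementNumber : Graph → ℕ ⁺ → Set
IsReinforcementNumber G [ r ] =
  IsLeast (λ k → ∃[ F ] (Reinforcing G F × length F ≡ k)) r
IsReinforcementNumber G ⊤⁺ = ¬ (∃[ F ] Reinforcing G F)

ReinforcementNumber≤ : ℕ → Graph → Set
ReinforcementNumber≤ k G = ∃[ r ] (IsReinforcementNumber G r × r ≤⁺ [ k ])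

-- (true , i) is the i-th variable, (false , i) its negation.
Literal : ℕ → Set
Literal m = Bool × Fin m

record Formula : Set where
  constructor mkFormula
  field
    vars    : ℕ
    clauses : List (Vec (Literal vars) 3)

open Formula public

Satisfiable : Formula → Set
Satisfiable φ =
  Σ (Fin (vars φ) → Bool) λ τ →
    All (Any (λ (sign , i) → τ i ≡ sign)) (clauses φ)

-- Vertices and variables are numbered in unary.  Since an instance lists
-- all its vertices or variables anyway, the length of the encoding is
-- polynomially related to that of the binary one.
unary : ℕ → List Bool
unary k = replicate k true ++ false ∷ []

encodeList : {A : Set} → (A → List Bool) → List A → List Bool
encodeList enc []       = false ∷ []
encodeList enc (x ∷ xs) = true ∷ enc x ++ encodeList enc xs

encodeGraph : Graph → List Bool
encodeGraph G =
  unary (n G) ++ encodeList (λ (u , v) → unary (toℕ u) ++ unary (toℕ v)) (edges G)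

encodeClause : ∀ {m k} → Vec (Literal m) k → List Bool
encodeClause []               = []
encodeClause ((sign , i) ∷ c) = sign ∷ unary (toℕ i) ++ encodeClause c

encodeFormula : Formula → List Bool
encodeFormula φ = unary (vars φ) ++ encodeList encodeClause (clauses φ)

-- The machines are deterministic multi-tape Turing machines over the tape
-- alphabet {0, 1, blank}; nothing is the blank.
Cell : Set
Cell = Maybe Bool

data Move : Set where
  left stay right : Move

-- A two-way infinite tape.  Both lists start next to the head; cells
-- beyond their ends are blank.
record Tape : Set where
  constructor tape
  field
    before  : List Cell
    scanned : Cell
    after   : List Cell

open Tape public

blankTape : Tape
blankTape = tape [] nothing []

move : Move → Tape → Tape
move stay  t                    = t
move left  (tape []       c rs) = tape [] nothing (c ∷ rs)
move left  (tape (l ∷ ls) c rs) = tape ls l (c ∷ rs)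
move right (tape ls c [])       = tape (c ∷ ls) nothing []
move right (tape ls c (r ∷ rs)) = tape (c ∷ ls) r rs

act : Cell × Move → Tape → Tape
act (c , m) (tape ls _ rs) = move m (tape ls c rs)

inputTape : List Bool → Tape
inputTape []       = blankTape
inputTape (b ∷ bs) = tape [] (just b) (map just bs)

untilBlank : List Cell → List Bool
untilBlank []             = []
untilBlank (nothing ∷ _)  = []
untilBlank (just b ∷ cs)  = b ∷ untilBlank cs

-- Tape 0 is the input tape and tape 1 the output tape.  The machine halts
-- when δ returns nothing.
record TM : Set₁ where
  field
    State  : Set
    size   : ℕ
    finite : State ↔ Fin size
    start  : State
    work   : ℕ
    δ      : State → Vec Cell (2 + work) →
             Maybe (State × Vec (Cell × Move) (2 + work))

module _ (M : TM) where
  open TM M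

  Config : Set
  Config = State × Vec Tape (2 + work)

  step : Config → Maybe Config
  step (q , ts) =
    Maybe.map (λ (q′ , as) → q′ , zipWith act as ts) (δ q (Vec.map scanned ts))

  initial : List Bool → Config
  initial x = start , inputTape x ∷ Vec.replicate (1 + work) blankTape

  -- The string on the output tape from the head up to the first blank.
  output : Config → List Bool
  output (_ , _ ∷ t ∷ _) = untilBlank (scanned t ∷ after t)

  -- Starting from the first configuration, M halts after exactly t steps
  -- in the second one.
  data HaltsIn : Config → ℕ → Config → Set where
    done : ∀ {c} → step c ≡ nothing → HaltsIn c 0 c
    next : ∀ {c c′ c″ t} → step c ≡ just c′ → HaltsIn c′ t c″ →
           HaltsIn c (suc t) c″

  -- On input x, M outputs y after exactly t steps.
  Outputs : List Bool → List Bool → ℕ → Set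
  Outputs x y t = ∃[ c ] (HaltsIn (initial x) t c × output c ≡ y)

record Problem : Set₁ where
  field
    Instance : Set
    encode   : Instance → List Bool
    Yes      : Instance → Set

open Problem public

record PolyTime (A B : Problem) (f : Instance A → Instance B) : Set₁ where
  field
    machine  : TM
    a d      : ℕ
    computes : ∀ x → ∃[ t ]
      ( Outputs machine (encode A x) (encode B (f x)) t
      × t ≤ a * length (encode A x) ^ d + a )

infix 4 _≤ₚ_

record _≤ₚ_ (A B : Problem) : Set₁ where
  field
    transform : Instance A → Instance B
    correct   : ∀ x → Yes A x ⇔ Yes B (transform x)
    polyTime  : PolyTime A B transform

ThreeSAT : Problem
ThreeSAT = record
  { Instance = Formula
  ; encode   = encodeFormula
  ; Yes      = Satisfiable
  }

-- NP-hardness is defined by reduction from the NP-complete problem 3SAT.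
NPHard : Problem → Set₁
NPHard B = ThreeSAT ≤ₚ B

-- Restricted to bipartite graphs and to a fixed k: a transformation into
-- this problem has to produce a bipartite graph on every instance.
BipartiteReinforcement : ℕ → Problem
BipartiteReinforcement k = record
  { Instance = Σ Graph Bipartite
  ; encode   = λ (G , _) → encodeGraph G
  ; Yes      = λ (G , _) → ReinforcementNumber≤ k G
  }

{-# OPTIONS --safe #-}
module Submission where

open import Defs

open import Algebra.Properties.CommutativeSemigroup using (interchange)
open import Data.Bool.Base using (Bool; true; false; not; if_then_else_)
open import Data.Fin.Base using (Fin; zero; suc; toℕ; combine; _↑ˡ_; _↑ʳ_)
open import Data.Fin.Patterns
open import Data.Fin.Properties
  using (+↔⊎; *↔×; 1↔⊤; toℕ-combine; toℕ-↑ˡ; toℕ-↑ʳ; toℕ<n)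
open import Data.Fin.Subset using (Subset; ⊥; _∈_; _∉_; ∣_∣)
open import Data.Fin.Subset.Properties using (∣⊥∣≡0)
open import Data.List.Base using (List; []; _∷_; _++_; length; map; replicate; lookup)
import Data.List.Membership.Propositional as List
open import Data.List.Membership.Propositional.Properties
  using (∈-++⁺ˡ; ∈-++⁺ʳ; ∈-map⁺; ∈-lookup)
open import Data.List.Properties using (++-assoc; length-++; length-replicate)
open import Data.List.Relation.Unary.All as All using (All; []; _∷_)
import Data.List.Relation.Unary.All.Properties as All
open import Data.List.Relation.Unary.AllPairs using ([]; _∷_)
open import Data.List.Relation.Unary.Any using (here; there; index)
open import Data.List.Relation.Unary.Any.Properties using (lookup-index)
open import Data.Maybe.Base as Maybe using (Maybe; just; nothing; maybe′)
open import Data.Nat.Base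
  using (ℕ; zero; suc; _+_; _*_; _^_; _≤_; _<_; z≤n; s≤s; s≤s⁻¹)
open import Data.Nat.Properties
open import Data.Nat.Tactic.RingSolver using (solve-∀)
open import Data.Product.Base using (∃-syntax; _×_; _,_; proj₁; proj₂; uncurry)
open import Data.Sum.Base as Sum using (_⊎_; inj₁; inj₂)
open import Data.Sum.Function.Propositional using (_⊎-↔_)
open import Data.Unit.Base using (⊤; tt)
open import Data.Vec.Base as Vec using (Vec; []; _∷_; zipWith)
import Data.Vec.Membership.Propositional as Vec
open import Data.Vec.Properties
  using (lookup-++ˡ; lookup-++ʳ; lookup-concat; lookup∘tabulate; lookup⇒[]=; []=⇒lookup)
import Data.Vec.Relation.Unary.Any as VecAny
open import Function.Base using (_∘_; id)
open import Function.Bundles using (_↔_; Inverse; _⇔_; mk⇔)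
open import Function.Construct.Composition using (_↔-∘_)
open import Function.Construct.Identity using (↔-id)
open import Function.Construct.Symmetry using (↔-sym)
open import Relation.Binary.Construct.Add.Supremum.NonStrict _≤_ using ([_])
open import Relation.Binary.PropositionalEquality
open import Relation.Nullary.Construct.Add.Supremum using ([_])
open import Relation.Nullary.Negation using (¬_; contradiction)

-- The graph of a formula with m variables has a 4-cycle pos, mid₀, neg, mid₁
-- for each variable, a hub adjacent to all literal vertices and to two
-- pendants, a vertex for each clause adjacent to its literals, and an apex
-- adjacent to all clauses.  Each 4-cycle, the hub with its pendants, and the
-- apex with the clauses need a dominator of their own, and the hub, the apex
-- and one literal of each variable dominate the graph, so γ = m + 2.  A
-- satisfying assignment and the edge from the hub to the apex save the apex.
-- Conversely, an added edge spares at most one vertex.  Two vertices of each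
-- 4-cycle and both pendants have no neighbours outside their group, so these
-- groups still need m + 1 vertices; a dominating set of this size has exactly
-- one vertex in each of them and none among the apex and the clauses.  The
-- edge is then spent on the apex, and the clauses are dominated by literals,
-- at most one for each variable.
--
-- The machine reads the formula once.  It keeps the number of the next vertex
-- in unary on its work tape and writes the code of the graph from right to
-- left, so that the number of vertices, known only at the end, comes first.

-- Structured programs and their compilation to Turing machines

Instruction : ℕ → Set
Instruction k = Vec Cell k → Vec (Cell × Move) k

Test : ℕ → Set
Test k = Vec Cell k → Bool

infixr 5 _⨾_

data Program (k : ℕ) : Set where
  instr  : Instruction k → Program k
  _⨾_    : Program k → Program k → Program k
  branch : Test k → Program k → Program k → Program k
  while  : Test k → Program k → Program k

module _ {k : ℕ} where

  Label : Program k → Set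
  Label (instr f)      = ⊤
  Label (p ⨾ q)        = Label p ⊎ Label q
  Label (branch c p q) = ⊤ ⊎ (Label p ⊎ Label q)
  Label (while c p)    = ⊤ ⊎ Label p

  entry : ∀ p → Label p
  entry (instr f)      = tt
  entry (p ⨾ q)        = inj₁ (entry p)
  entry (branch c p q) = inj₁ tt
  entry (while c p)    = inj₁ tt

  idle : Instruction k
  idle = Vec.map (_, stay)

  -- The successor label nothing means that the program is left.
  transition : ∀ p → Label p → Vec Cell k → Maybe (Label p) × Vec (Cell × Move) k
  transition (instr f) tt cs = nothing , f cs
  transition (p ⨾ q) (inj₁ l) cs =
    let l′ , as = transition p l cs in just (maybe′ inj₁ (inj₂ (entry q)) l′) , as
  transition (p ⨾ q) (inj₂ l) cs =
    let l′ , as = transition q l cs in Maybe.map inj₂ l′ , as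
  transition (branch c p q) (inj₁ tt) cs =
    just (inj₂ (if c cs then inj₁ (entry p) else inj₂ (entry q))) , idle cs
  transition (branch c p q) (inj₂ (inj₁ l)) cs =
    let l′ , as = transition p l cs in Maybe.map (inj₂ ∘ inj₁) l′ , as
  transition (branch c p q) (inj₂ (inj₂ l)) cs =
    let l′ , as = transition q l cs in Maybe.map (inj₂ ∘ inj₂) l′ , as
  transition (while c p) (inj₁ tt) cs =
    (if c cs then just (inj₂ (entry p)) else nothing) , idle cs
  transition (while c p) (inj₂ l) cs =
    let l′ , as = transition p l cs in just (maybe′ inj₂ (inj₁ tt) l′) , as

  labelCount : Program k → ℕ
  labelCount (instr f)      = 1
  labelCount (p ⨾ q)        = labelCount p + labelCount q
  labelCount (branch c p q) = 1 + (labelCount p + labelCount q)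
  labelCount (while c p)    = 1 + labelCount p

  ⊎↔+ : ∀ {A B : Set} {m n} → A ↔ Fin m → B ↔ Fin n → (A ⊎ B) ↔ Fin (m + n)
  ⊎↔+ f g = ↔-sym +↔⊎ ↔-∘ (f ⊎-↔ g)

  label-finite : ∀ p → Label p ↔ Fin (labelCount p)
  label-finite (instr f)      = ↔-sym 1↔⊤
  label-finite (p ⨾ q)        = ⊎↔+ (label-finite p) (label-finite q)
  label-finite (branch c p q) = ⊎↔+ (↔-sym 1↔⊤) (⊎↔+ (label-finite p) (label-finite q))
  label-finite (while c p)    = ⊎↔+ (↔-sym 1↔⊤) (label-finite p)

  Tapes : Set
  Tapes = Vec Tape k

  perform : Vec (Cell × Move) k → Tapes → Tapes
  perform = zipWith act

  -- Leaving the program is itself a step that performs its actions, so the index counts machine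
  -- steps exactly.
  data Reach (p : Program k) : Label p → Tapes → ℕ → Tapes → Set where
    last : ∀ {l ts as} → transition p l (Vec.map scanned ts) ≡ (nothing , as) →
           Reach p l ts 1 (perform as ts)
    more : ∀ {l l′ ts as t ts′} →
           transition p l (Vec.map scanned ts) ≡ (just l′ , as) →
           Reach p l′ (perform as ts) t ts′ → Reach p l ts (suc t) ts′

  perform-idle : ∀ {n} (ts : Vec Tape n) →
                 zipWith act (Vec.map (_, stay) (Vec.map scanned ts)) ts ≡ ts
  perform-idle []       = refl
  perform-idle (t ∷ ts) = cong (t ∷_) (perform-idle ts)

  -- The transition of a compound program is by definition the image of that of its part, so `cong`
  -- lifts each step.
  reach-⨾ʳ : ∀ {p q l ts t ts′} → Reach q l ts t ts′ → Reach (p ⨾ q) (inj₂ l) ts t ts′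
  reach-⨾ʳ (last eq) = last (cong (λ (l , as) → Maybe.map inj₂ l , as) eq)
  reach-⨾ʳ (more eq r) = more (cong (λ (l , as) → Maybe.map inj₂ l , as) eq) (reach-⨾ʳ r)

  reach-⨾ : ∀ {p q l ts t ts′ u ts″} → Reach p l ts t ts′ →
            Reach q (entry q) ts′ u ts″ → Reach (p ⨾ q) (inj₁ l) ts (t + u) ts″
  reach-⨾ (last eq) r =
    more (cong (λ (l , as) → just (maybe′ inj₁ (inj₂ _) l) , as) eq) (reach-⨾ʳ r)
  reach-⨾ (more eq r′) r =
    more (cong (λ (l , as) → just (maybe′ inj₁ (inj₂ _) l) , as) eq) (reach-⨾ r′ r)

  reach-branchˡ : ∀ {c p q l ts t ts′} → Reach p l ts t ts′ →
                  Reach (branch c p q) (inj₂ (inj₁ l)) ts t ts′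
  reach-branchˡ (last eq) = last (cong (λ (l , as) → Maybe.map _ l , as) eq)
  reach-branchˡ (more eq r) = more (cong (λ (l , as) → Maybe.map _ l , as) eq) (reach-branchˡ r)

  reach-branchʳ : ∀ {c p q l ts t ts′} → Reach q l ts t ts′ →
                  Reach (branch c p q) (inj₂ (inj₂ l)) ts t ts′
  reach-branchʳ (last eq) = last (cong (λ (l , as) → Maybe.map _ l , as) eq)
  reach-branchʳ (more eq r) = more (cong (λ (l , as) → Maybe.map _ l , as) eq) (reach-branchʳ r)

  reach-body : ∀ {c p l ts t ts′ u ts″} → Reach p l ts t ts′ →
               Reach (while c p) (inj₁ tt) ts′ u ts″ →
               Reach (while c p) (inj₂ l) ts (t + u) ts″
  reach-body (last eq) r =
    more (cong (λ (l , as) → just (maybe′ inj₂ (inj₁ tt) l) , as) eq) r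
  reach-body (more eq r′) r =
    more (cong (λ (l , as) → just (maybe′ inj₂ (inj₁ tt) l) , as) eq) (reach-body r′ r)

  -- The exact time stays inside, where `HaltsIn` will ask for it, while the bound `n` lets runs of
  -- varying length be composed.
  Runs : Program k → Tapes → ℕ → Tapes → Set
  Runs p ts n ts′ = ∃[ t ] (t ≤ n × Reach p (entry p) ts t ts′)

  runs-instr : ∀ f ts → Runs (instr f) ts 1 (perform (f (Vec.map scanned ts)) ts)
  runs-instr f ts = 1 , ≤-refl , last refl

  runs-⨾ : ∀ {p q ts m ts′ n ts″} → Runs p ts m ts′ → Runs q ts′ n ts″ →
           Runs (p ⨾ q) ts (m + n) ts″
  runs-⨾ (_ , t≤m , r) (_ , u≤n , r′) = _ , +-mono-≤ t≤m u≤n , reach-⨾ r r′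

  -- The test costs one step; it rewrites the scanned cells without moving, so `perform-idle` gives
  -- back the same tapes.
  runs-branch-true : ∀ {c p q ts n ts′} → c (Vec.map scanned ts) ≡ true →
                     Runs p ts n ts′ → Runs (branch c p q) ts (suc n) ts′
  runs-branch-true {ts = ts} eq (_ , t≤n , r) = _ , s≤s t≤n ,
    more (cong (λ b → just (inj₂ (if b then inj₁ _ else inj₂ _)) , _) eq)
         (subst (λ ts → Reach _ _ ts _ _) (sym (perform-idle ts)) (reach-branchˡ r))

  runs-branch-false : ∀ {c p q ts n ts′} → c (Vec.map scanned ts) ≡ false →
                      Runs q ts n ts′ → Runs (branch c p q) ts (suc n) ts′
  runs-branch-false {ts = ts} eq (_ , t≤n , r) = _ , s≤s t≤n ,
    more (cong (λ b → just (inj₂ (if b then inj₁ _ else inj₂ _)) , _) eq)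
         (subst (λ ts → Reach _ _ ts _ _) (sym (perform-idle ts)) (reach-branchʳ r))

  runs-while-false : ∀ {c p ts} → c (Vec.map scanned ts) ≡ false →
                     Runs (while c p) ts 1 ts
  runs-while-false {c} {p} {ts} eq = 1 , ≤-refl ,
    subst (Reach _ _ ts 1) (perform-idle ts)
      (last (cong (λ b → (if b then just (inj₂ (entry p)) else nothing) , _) eq))

  runs-while-true : ∀ {c p ts m ts′ n ts″} → c (Vec.map scanned ts) ≡ true →
                    Runs p ts m ts′ → Runs (while c p) ts′ n ts″ →
                    Runs (while c p) ts (suc (m + n)) ts″
  runs-while-true {c} {p} {ts} eq (_ , t≤m , r) (_ , u≤n , r′) =
    _ , s≤s (+-mono-≤ t≤m u≤n) ,
    more (cong (λ b → (if b then just (inj₂ (entry p)) else nothing) , _) eq)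
         (subst (λ ts → Reach _ _ ts _ _) (sym (perform-idle ts)) (reach-body r r′))

module _ {k : ℕ} (p : Program (2 + k)) where

  compile : TM
  compile = record
    { State  = Label p ⊎ ⊤
    ; size   = labelCount p + 1
    ; finite = ⊎↔+ {k = k} (label-finite p) (↔-sym 1↔⊤)
    ; start  = inj₁ (entry p)
    ; work   = k
    ; δ      = δ′
    }
    where
    δ′ : Label p ⊎ ⊤ → Vec Cell (2 + k) → Maybe ((Label p ⊎ ⊤) × Vec (Cell × Move) (2 + k))
    δ′ (inj₁ l) cs = let l′ , as = transition p l cs in just (maybe′ inj₁ (inj₂ tt) l′ , as)
    δ′ (inj₂ _) _  = nothing

  -- The step that leaves the program enters the additional state, where `δ` is `nothing`; the time
  -- is therefore unchanged.
  compile-halts : ∀ {l ts t ts′} → Reach p l ts t ts′ →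
                  HaltsIn compile (inj₁ l , ts) t (inj₂ tt , ts′)
  compile-halts {ts = ts} (last eq) =
    next (cong (λ (l , as) → just (maybe′ inj₁ (inj₂ tt) l , perform as ts)) eq) (done refl)
  compile-halts {ts = ts} (more eq r) =
    next (cong (λ (l , as) → just (maybe′ inj₁ (inj₂ tt) l , perform as ts)) eq) (compile-halts r)

-- The graph of a formula

HasNeighbourIn : (G : Graph) → Subset (n G) → Fin (n G) → Set
HasNeighbourIn G D v = ∃[ u ] (u ∈ D × Adj G v u)

-- What domination after adding one edge still says about `G` itself, so that one counting argument
-- covers both graphs.
AlmostDominating : (G : Graph) → Subset (n G) → Set
AlmostDominating G D =
  ∀ u v → u ≢ v → u ∉ D → v ∉ D → HasNeighbourIn G D u ⊎ HasNeighbourIn G D v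

dominating⇒almostDominating : ∀ G {D} → Dominating G D → AlmostDominating G D
dominating⇒almostDominating G dom u v _ u∉D _ = inj₁ (dom u u∉D)

-- A new edge xy dominates x only if y ∈ D, and then y needs no neighbour.
addEdge-almostDominating : ∀ G {D} e o → Dominating (addEdges G (e ∷ []) o) D →
                           AlmostDominating G D
addEdge-almostDominating G {D} e o dom u v u≢v u∉D v∉D = cases (dom u u∉D) (dom v v∉D)
  where
  H = addEdges G (e ∷ []) o
  cases : HasNeighbourIn H D u → HasNeighbourIn H D v →
          HasNeighbourIn G D u ⊎ HasNeighbourIn G D v
  cases (w , w∈D , inj₁ (there uw)) _ = inj₁ (w , w∈D , inj₁ uw)
  cases (w , w∈D , inj₂ (there wu)) _ = inj₁ (w , w∈D , inj₂ wu)
  cases _ (w , w∈D , inj₁ (there vw)) = inj₂ (w , w∈D , inj₁ vw)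
  cases _ (w , w∈D , inj₂ (there wv)) = inj₂ (w , w∈D , inj₂ wv)
  cases (_ , _ , inj₁ (here refl)) (_ , _ , inj₁ (here refl)) = contradiction refl u≢v
  cases (_ , w∈D , inj₁ (here refl)) (_ , _ , inj₂ (here refl)) = contradiction w∈D v∉D
  cases (_ , w∈D , inj₂ (here refl)) (_ , _ , inj₁ (here refl)) = contradiction w∈D v∉D
  cases (_ , _ , inj₂ (here refl)) (_ , _ , inj₂ (here refl)) = contradiction refl u≢v

-- Cardinalities of concatenated subsets

∣++∣ : ∀ {m n} (p : Subset m) (q : Subset n) → ∣ p Vec.++ q ∣ ≡ ∣ p ∣ + ∣ q ∣
∣++∣ []          q = refl
∣++∣ (true  ∷ p) q = cong suc (∣++∣ p q)
∣++∣ (false ∷ p) q = ∣++∣ p q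

lookup-true⇒1≤∣p∣ : ∀ {n} (p : Subset n) i → Vec.lookup p i ≡ true → 1 ≤ ∣ p ∣
lookup-true⇒1≤∣p∣ (true  ∷ p) zero    _  = s≤s z≤n
lookup-true⇒1≤∣p∣ (true  ∷ p) (suc i) eq = s≤s z≤n
lookup-true⇒1≤∣p∣ (false ∷ p) (suc i) eq = lookup-true⇒1≤∣p∣ p i eq

∣p∣≡0⇒lookup-false : ∀ {n} (p : Subset n) i → ∣ p ∣ ≡ 0 → Vec.lookup p i ≡ false
∣p∣≡0⇒lookup-false (false ∷ p) zero    _  = refl
∣p∣≡0⇒lookup-false (false ∷ p) (suc i) eq = ∣p∣≡0⇒lookup-false p i eq

m≤∣concat∣ : ∀ {m k} (ps : Vec (Subset k) m) → (∀ i → 1 ≤ ∣ Vec.lookup ps i ∣) →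
             m ≤ ∣ Vec.concat ps ∣
m≤∣concat∣ []       _ = z≤n
m≤∣concat∣ (p ∷ ps) h rewrite ∣++∣ p (Vec.concat ps) =
  +-mono-≤ (h zero) (m≤∣concat∣ ps (h ∘ suc))

-- Pigeonhole: each of the other blocks takes at least one of the at most `m` elements, which leaves
-- at most one for block `i`.
∣concat∣≤m⇒singletons : ∀ {m k} (ps : Vec (Subset k) m) →
                        (∀ i → 1 ≤ ∣ Vec.lookup ps i ∣) → ∣ Vec.concat ps ∣ ≤ m →
                        ∀ i → ∣ Vec.lookup ps i ∣ ≤ 1
∣concat∣≤m⇒singletons {suc m} (p ∷ ps) h le i rewrite ∣++∣ p (Vec.concat ps) with i
... | zero  = +-cancelʳ-≤ m ∣ p ∣ 1
                (≤-trans (+-monoʳ-≤ ∣ p ∣ (m≤∣concat∣ ps (h ∘ suc))) le)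
... | suc j = ∣concat∣≤m⇒singletons ps (h ∘ suc)
                (s≤s⁻¹ (≤-trans (+-monoˡ-≤ ∣ Vec.concat ps ∣ (h zero)) le)) j

∣concat∣-singletons : ∀ {m k} (ps : Vec (Subset k) m) →
                      (∀ i → ∣ Vec.lookup ps i ∣ ≡ 1) → ∣ Vec.concat ps ∣ ≡ m
∣concat∣-singletons []       _ = refl
∣concat∣-singletons (p ∷ ps) h =
  trans (∣++∣ p (Vec.concat ps)) (cong₂ _+_ (h zero) (∣concat∣-singletons ps (h ∘ suc)))

-- Vertices, their numbering and the edge lists

Clause : ℕ → Set
Clause m = Vec (Literal m) 3

-- Four vertices independent of the formula, four for each of the m variables
-- and one for each of the l clauses.
Vertex : ℕ → ℕ → Set
Vertex m l = Fin 4 ⊎ ((Fin m × Fin 4) ⊎ Fin l)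

pattern pendant₀ = inj₁ 0F
pattern pendant₁ = inj₁ 1F
pattern hub      = inj₁ 2F
pattern apex     = inj₁ 3F
pattern gadget i k = inj₂ (inj₁ (i , k))
pattern pos i    = inj₂ (inj₁ (i , 0F))
pattern neg i    = inj₂ (inj₁ (i , 1F))
pattern mid₀ i   = inj₂ (inj₁ (i , 2F))
pattern mid₁ i   = inj₂ (inj₁ (i , 3F))
pattern clause j = inj₂ (inj₂ j)

module Layout (m l : ℕ) where

  literal : Literal m → Vertex m l
  literal (true  , i) = pos i
  literal (false , i) = neg i

  -- Fixed vertices, gadgets and clauses are numbered in the order in which the machine meets them,
  -- so a single counter can hold the first vertex of the current gadget or the current clause
  -- vertex.
  Fin↔Vertex : Fin (4 + (m * 4 + l)) ↔ Vertex m l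
  Fin↔Vertex = (↔-id _ ⊎-↔ ((*↔× ⊎-↔ ↔-id _) ↔-∘ +↔⊎ {m * 4})) ↔-∘ +↔⊎ {4}

  code : Vertex m l → Fin (4 + (m * 4 + l))
  code = Inverse.from Fin↔Vertex

  decode : Fin (4 + (m * 4 + l)) → Vertex m l
  decode = Inverse.to Fin↔Vertex

  decode-code : ∀ a → decode (code a) ≡ a
  decode-code = Inverse.strictlyInverseˡ Fin↔Vertex

  code-decode : ∀ v → code (decode v) ≡ v
  code-decode = Inverse.strictlyInverseʳ Fin↔Vertex

  code-injective : ∀ {a b} → code a ≡ code b → a ≡ b
  code-injective {a} {b} eq = trans (sym (decode-code a)) (trans (cong decode eq) (decode-code b))

  number : Vertex m l → ℕ
  number a = toℕ (code a)

  number-gadget : ∀ i k → number (gadget i k) ≡ 4 + (toℕ i * 4 + toℕ k)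
  number-gadget i k = cong (4 +_) (trans (toℕ-↑ˡ (combine i k) l)
    (trans (toℕ-combine i k) (cong (_+ toℕ k) (*-comm 4 (toℕ i)))))

  number-clause : ∀ j → number (clause j) ≡ 4 + (m * 4 + toℕ j)
  number-clause j = cong (4 +_) (toℕ-↑ʳ (m * 4) j)

  gadget<clause : ∀ i k j → number (gadget i k) < number (clause j)
  gadget<clause i k j rewrite number-clause j | toℕ-↑ˡ (combine i k) l =
    +-monoʳ-< 4 (≤-trans (toℕ<n (combine i k)) (m≤m+n (m * 4) (toℕ j)))

  gadget-mono : ∀ i {k k′} → toℕ k < toℕ k′ → number (gadget i k) < number (gadget i k′)
  gadget-mono i {k} {k′} k<k′ rewrite number-gadget i k | number-gadget i k′ =
    +-monoʳ-< 4 (+-monoʳ-< (toℕ i * 4) k<k′)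

  -- The edge lists are built in the order in which the machine writes them,
  -- the last edge written being the head of the list.
  baseEdges : List (Vertex m l × Vertex m l)
  baseEdges = (pendant₁ , hub) ∷ (pendant₀ , hub) ∷ []

  gadgetEdges : Fin m → List (Vertex m l × Vertex m l)
  gadgetEdges i = (pos i , mid₀ i) ∷ (neg i , mid₀ i) ∷ (pos i , mid₁ i) ∷
                  (neg i , mid₁ i) ∷ (hub , pos i) ∷ (hub , neg i) ∷ []

  -- `ι` embeds the `r` variables still to come and the list argument collects the edges already
  -- written, so the recursion mirrors the loop of the machine.
  variableEdges : ∀ r → (Fin r → Fin m) →
                  List (Vertex m l × Vertex m l) → List (Vertex m l × Vertex m l)
  variableEdges zero    ι es = es
  variableEdges (suc r) ι es = variableEdges r (ι ∘ suc) (gadgetEdges (ι zero) ++ es)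

  literalEdges : ∀ {k} → Fin l → Vec (Literal m) k →
                 List (Vertex m l × Vertex m l) → List (Vertex m l × Vertex m l)
  literalEdges j []      es = es
  literalEdges j (x ∷ c) es = literalEdges j c ((literal x , clause j) ∷ es)

  clauseEdges : (cs : List (Clause m)) → (Fin (length cs) → Fin l) →
                List (Vertex m l × Vertex m l) → List (Vertex m l × Vertex m l)
  clauseEdges []       ι es = es
  clauseEdges (c ∷ cs) ι es = clauseEdges cs (ι ∘ suc)
    (literalEdges (ι zero) c ((apex , clause (ι zero)) ∷ es))

  ∈-variableEdgesʳ : ∀ {e} r ι {es} → e List.∈ es → e List.∈ variableEdges r ι es
  ∈-variableEdgesʳ zero    ι e∈ = e∈
  ∈-variableEdgesʳ (suc r) ι e∈ =
    ∈-variableEdgesʳ r (ι ∘ suc) (∈-++⁺ʳ (gadgetEdges (ι zero)) e∈)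

  ∈-variableEdges : ∀ {e} r ι {es} k → e List.∈ gadgetEdges (ι k) →
                    e List.∈ variableEdges r ι es
  ∈-variableEdges (suc r) ι zero    e∈ = ∈-variableEdgesʳ r (ι ∘ suc) (∈-++⁺ˡ e∈)
  ∈-variableEdges (suc r) ι (suc k) e∈ = ∈-variableEdges r (ι ∘ suc) k e∈

  ∈-literalEdgesʳ : ∀ {e j k} (c : Vec (Literal m) k) {es} → e List.∈ es →
                    e List.∈ literalEdges j c es
  ∈-literalEdgesʳ []      e∈ = e∈
  ∈-literalEdgesʳ (x ∷ c) e∈ = ∈-literalEdgesʳ c (there e∈)

  ∈-literalEdges : ∀ {j k x} (c : Vec (Literal m) k) {es} → x Vec.∈ c →
                   (literal x , clause j) List.∈ literalEdges j c es
  ∈-literalEdges (_ ∷ c) (VecAny.here refl) = ∈-literalEdgesʳ c (here refl)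
  ∈-literalEdges (_ ∷ c) (VecAny.there x∈c) = ∈-literalEdges c x∈c

  ∈-clauseEdgesʳ : ∀ {e} cs ι {es} → e List.∈ es → e List.∈ clauseEdges cs ι es
  ∈-clauseEdgesʳ []       ι e∈ = e∈
  ∈-clauseEdgesʳ (c ∷ cs) ι e∈ = ∈-clauseEdgesʳ cs (ι ∘ suc) (∈-literalEdgesʳ c (there e∈))

  apex∈clauseEdges : ∀ cs ι {es} k → (apex , clause (ι k)) List.∈ clauseEdges cs ι es
  apex∈clauseEdges (c ∷ cs) ι zero =
    ∈-clauseEdgesʳ cs (ι ∘ suc) (∈-literalEdgesʳ c (here refl))
  apex∈clauseEdges (c ∷ cs) ι (suc k) = apex∈clauseEdges cs (ι ∘ suc) k

  literal∈clauseEdges : ∀ cs ι {es} k {x} → x Vec.∈ lookup cs k →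
                        (literal x , clause (ι k)) List.∈ clauseEdges cs ι es
  literal∈clauseEdges (c ∷ cs) ι zero x∈c =
    ∈-clauseEdgesʳ cs (ι ∘ suc) (∈-literalEdges c x∈c)
  literal∈clauseEdges (c ∷ cs) ι (suc k) x∈c = literal∈clauseEdges cs (ι ∘ suc) k x∈c

module Reduction (φ : Formula) where

  m l : ℕ
  m = vars φ
  l = length (clauses φ)

  open Layout m l

  V : Set
  V = Vertex m l

  -- A specification of adjacency free of the order of `links`, on which neighbourhoods can be found
  -- by matching. Every edge points to the larger number, as `ordered` demands.
  data Link : V → V → Set where
    pendant₀-hub : Link pendant₀ hub
    pendant₁-hub : Link pendant₁ hub
    hub-pos      : ∀ i → Link hub (pos i)
    hub-neg      : ∀ i → Link hub (neg i)
    pos-mid₀     : ∀ i → Link (pos i) (mid₀ i)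
    pos-mid₁     : ∀ i → Link (pos i) (mid₁ i)
    neg-mid₀     : ∀ i → Link (neg i) (mid₀ i)
    neg-mid₁     : ∀ i → Link (neg i) (mid₁ i)
    apex-clause  : ∀ j → Link apex (clause j)
    pos-clause   : ∀ {i} j → (true  , i) Vec.∈ lookup (clauses φ) j → Link (pos i) (clause j)
    neg-clause   : ∀ {i} j → (false , i) Vec.∈ lookup (clauses φ) j → Link (neg i) (clause j)

  Linked : V → V → Set
  Linked a b = Link a b ⊎ Link b a

  literal-clause : ∀ {x} j → x Vec.∈ lookup (clauses φ) j → Link (literal x) (clause j)
  literal-clause {true  , i} = pos-clause
  literal-clause {false , i} = neg-clause

  links : List (V × V)
  links = clauseEdges (clauses φ) id (variableEdges m id baseEdges)

  gadgetEdges-link : ∀ i → All (uncurry Link) (gadgetEdges i)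
  gadgetEdges-link i =
    pos-mid₀ i ∷ neg-mid₀ i ∷ pos-mid₁ i ∷ neg-mid₁ i ∷ hub-pos i ∷ hub-neg i ∷ []

  variableEdges-link : ∀ r ι {es} → All (uncurry Link) es →
                       All (uncurry Link) (variableEdges r ι es)
  variableEdges-link zero    ι h = h
  variableEdges-link (suc r) ι h =
    variableEdges-link r (ι ∘ suc) (All.++⁺ (gadgetEdges-link (ι zero)) h)

  literalEdges-link : ∀ {k} j (c : Vec (Literal m) k) {es} →
                      (∀ {x} → x Vec.∈ c → x Vec.∈ lookup (clauses φ) j) →
                      All (uncurry Link) es → All (uncurry Link) (literalEdges j c es)
  literalEdges-link j []      _   h = h
  literalEdges-link j (x ∷ c) c⊆ h =
    literalEdges-link j c (c⊆ ∘ VecAny.there) (literal-clause j (c⊆ (VecAny.here refl)) ∷ h)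

  clauseEdges-link : ∀ cs ι {es} → (∀ k → lookup (clauses φ) (ι k) ≡ lookup cs k) →
                     All (uncurry Link) es → All (uncurry Link) (clauseEdges cs ι es)
  clauseEdges-link []       ι eq h = h
  clauseEdges-link (c ∷ cs) ι eq h = clauseEdges-link cs (ι ∘ suc) (eq ∘ suc)
    (literalEdges-link (ι zero) c (subst (_ Vec.∈_) (sym (eq zero))) (apex-clause (ι zero) ∷ h))

  links-sound : All (uncurry Link) links
  links-sound = clauseEdges-link (clauses φ) id (λ _ → refl)
    (variableEdges-link m id (pendant₁-hub ∷ pendant₀-hub ∷ []))

  gadgetEdge∈links : ∀ {e} i → e List.∈ gadgetEdges i → e List.∈ links
  gadgetEdge∈links i e∈ = ∈-clauseEdgesʳ (clauses φ) id (∈-variableEdges m id i e∈)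

  baseEdge∈links : ∀ {e} → e List.∈ baseEdges → e List.∈ links
  baseEdge∈links e∈ = ∈-clauseEdgesʳ (clauses φ) id (∈-variableEdgesʳ m id e∈)

  links-complete : ∀ {a b} → Link a b → (a , b) List.∈ links
  links-complete pendant₀-hub     = baseEdge∈links (there (here refl))
  links-complete pendant₁-hub     = baseEdge∈links (here refl)
  links-complete (pos-mid₀ i)     = gadgetEdge∈links i (here refl)
  links-complete (neg-mid₀ i)     = gadgetEdge∈links i (there (here refl))
  links-complete (pos-mid₁ i)     = gadgetEdge∈links i (there (there (here refl)))
  links-complete (neg-mid₁ i)     = gadgetEdge∈links i (there (there (there (here refl))))
  links-complete (hub-pos i)      = gadgetEdge∈links i (there (there (there (there (here refl)))))
  links-complete (hub-neg i)      =
    gadgetEdge∈links i (there (there (there (there (there (here refl))))))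
  links-complete (apex-clause j)  = apex∈clauseEdges (clauses φ) id j
  links-complete (pos-clause j p) = literal∈clauseEdges (clauses φ) id j p
  links-complete (neg-clause j p) = literal∈clauseEdges (clauses φ) id j p

  link-< : ∀ {a b} → Link a b → number a < number b
  link-< pendant₀-hub     = s≤s z≤n
  link-< pendant₁-hub     = s≤s (s≤s z≤n)
  link-< (hub-pos i)      = s≤s (s≤s (s≤s z≤n))
  link-< (hub-neg i)      = s≤s (s≤s (s≤s z≤n))
  link-< (pos-mid₀ i)     = gadget-mono i (s≤s z≤n)
  link-< (pos-mid₁ i)     = gadget-mono i (s≤s z≤n)
  link-< (neg-mid₀ i)     = gadget-mono i (s≤s (s≤s z≤n))
  link-< (neg-mid₁ i)     = gadget-mono i (s≤s (s≤s z≤n))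
  link-< (apex-clause j)  = s≤s (s≤s (s≤s (s≤s z≤n)))
  link-< (pos-clause {i} j _) = gadget<clause i 0F j
  link-< (neg-clause {i} j _) = gadget<clause i 1F j

  G : Graph
  G = mkGraph (4 + (m * 4 + l)) (map (λ (a , b) → code a , code b) links)
              (All.map⁺ (All.map link-< links-sound))

  adj⇒linked : ∀ {u v} → Adj G u v → Linked (decode u) (decode v)
  adj⇒linked = Sum.map (All.lookup sound) (All.lookup sound)
    where
    sound : All (λ (u , v) → Link (decode u) (decode v)) (edges G)
    sound = All.map⁺ (All.map
      (λ {(a , b)} → subst₂ Link (sym (decode-code a)) (sym (decode-code b))) links-sound)

  adj-code⇒linked : ∀ {a v} → Adj G (code a) v → Linked a (decode v)
  adj-code⇒linked {a} adj = subst (λ a → Linked a _) (decode-code a) (adj⇒linked adj)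

  linked⇒adj : ∀ {a b} → Linked a b → Adj G (code a) (code b)
  linked⇒adj = Sum.map (∈-map⁺ _ ∘ links-complete) (∈-map⁺ _ ∘ links-complete)

  side : V → Bool
  side pendant₀   = false
  side pendant₁   = false
  side hub        = true
  side apex       = false
  side (pos i)    = false
  side (neg i)    = false
  side (mid₀ i)   = true
  side (mid₁ i)   = true
  side (clause j) = true

  link-sides : ∀ {a b} → Link a b → side a ≢ side b
  link-sides pendant₀-hub     ()
  link-sides pendant₁-hub     ()
  link-sides (hub-pos i)      ()
  link-sides (hub-neg i)      ()
  link-sides (pos-mid₀ i)     ()
  link-sides (pos-mid₁ i)     ()
  link-sides (neg-mid₀ i)     ()
  link-sides (neg-mid₁ i)     ()
  link-sides (apex-clause j)  ()
  link-sides (pos-clause j _) ()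
  link-sides (neg-clause j _) ()

  bipartite : Bipartite G
  bipartite = side ∘ decode , λ u v adj →
    Sum.[ link-sides , (λ lk → link-sides lk ∘ sym) ] (adj⇒linked {u} {v} adj)

  -- The groups that are counted separately: `core` holds the pendants and the hub, `top` the apex,
  -- `tops` the clause vertices.
  record Parts : Set where
    constructor parts
    field
      core    : Subset 3
      top     : Subset 1
      gadgets : Vec (Subset 4) m
      tops    : Subset l

  open Parts

  assemble : Parts → Subset (n G)
  assemble p = (core p Vec.++ top p) Vec.++ (Vec.concat (gadgets p) Vec.++ tops p)

  member : Parts → V → Bool
  member p (inj₁ k)     = Vec.lookup (core p Vec.++ top p) k
  member p (gadget i k) = Vec.lookup (Vec.lookup (gadgets p) i) k
  member p (clause j)   = Vec.lookup (tops p) j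

  lookup-assemble : ∀ p a → Vec.lookup (assemble p) (code a) ≡ member p a
  lookup-assemble p (inj₁ k) = lookup-++ˡ (core p Vec.++ top p) _ k
  lookup-assemble p (gadget i k) =
    trans (lookup-++ʳ (core p Vec.++ top p) _ (combine i k ↑ˡ l))
      (trans (lookup-++ˡ (Vec.concat (gadgets p)) (tops p) (combine i k))
        (lookup-concat (gadgets p) i k))
  lookup-assemble p (clause j) =
    trans (lookup-++ʳ (core p Vec.++ top p) _ (m * 4 ↑ʳ j))
      (lookup-++ʳ (Vec.concat (gadgets p)) (tops p) j)

  ∣assemble∣ : ∀ p → ∣ assemble p ∣ ≡
               (∣ core p ∣ + ∣ top p ∣) + (∣ Vec.concat (gadgets p) ∣ + ∣ tops p ∣)
  ∣assemble∣ p = trans (∣++∣ (core p Vec.++ top p) _)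
    (cong₂ _+_ (∣++∣ (core p) (top p)) (∣++∣ (Vec.concat (gadgets p)) (tops p)))

  -- Allows every bound to be proved for assembled sets only.
  assemble-surjective : ∀ D → ∃[ p ] D ≡ assemble p
  assemble-surjective (d₀ ∷ d₁ ∷ d₂ ∷ d₃ ∷ D) =
    let B , T , eq₁ = Vec.splitAt (m * 4) D
        gs , eq₂    = Vec.group m 4 B
    in parts (d₀ ∷ d₁ ∷ d₂ ∷ []) (d₃ ∷ []) gs T ,
       cong (λ D → d₀ ∷ d₁ ∷ d₂ ∷ d₃ ∷ D) (trans eq₁ (cong (Vec._++ T) eq₂))

  member⇒∈ : ∀ p a → member p a ≡ true → code a ∈ assemble p
  member⇒∈ p a eq = lookup⇒[]= (code a) _ (trans (lookup-assemble p a) eq)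

  ∈⇒member : ∀ p a → code a ∈ assemble p → member p a ≡ true
  ∈⇒member p a a∈ = trans (sym (lookup-assemble p a)) ([]=⇒lookup a∈)

  non-member⇒∉ : ∀ p a → member p a ≡ false → code a ∉ assemble p
  non-member⇒∉ p a eq a∈ with () ← trans (sym eq) (∈⇒member p a a∈)

  LinkedTo : Parts → V → Set
  LinkedTo p a = ∃[ b ] (member p b ≡ true × Linked a b)

  neighbour⇒linkedTo : ∀ p a → HasNeighbourIn G (assemble p) (code a) → LinkedTo p a
  neighbour⇒linkedTo p a (u , u∈D , adj) = decode u ,
    ∈⇒member p (decode u) (subst (_∈ assemble p) (sym (code-decode u)) u∈D) ,
    adj-code⇒linked adj

  -- Lower bounds for almost dominating sets

  module LowerBound (p : Parts) (almost : AlmostDominating G (assemble p)) where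

    almostLinked : ∀ a b → a ≢ b → member p a ≡ false → member p b ≡ false →
                   LinkedTo p a ⊎ LinkedTo p b
    almostLinked a b a≢b a∉ b∉ = Sum.map (neighbour⇒linkedTo p a) (neighbour⇒linkedTo p b)
      (almost (code a) (code b) (a≢b ∘ code-injective) (non-member⇒∉ p a a∉) (non-member⇒∉ p b b∉))

    core-nonempty : ∀ k → Vec.lookup (core p Vec.++ top p) (k ↑ˡ 1) ≡ true → 1 ≤ ∣ core p ∣
    core-nonempty k eq =
      lookup-true⇒1≤∣p∣ (core p) k (trans (sym (lookup-++ˡ (core p) (top p) k)) eq)

    -- If both pendants are missing, only one of them can be spared, and the other has no neighbour
    -- but the hub.
    1≤core : 1 ≤ ∣ core p ∣
    1≤core with member p pendant₀ in e₀ | member p pendant₁ in e₁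
    ... | true  | _     = core-nonempty 0F e₀
    ... | false | true  = core-nonempty 1F e₁
    ... | false | false with almostLinked pendant₀ pendant₁ (λ ()) e₀ e₁
    ...   | inj₁ (_ , hub∈ , inj₁ pendant₀-hub) = core-nonempty 2F hub∈
    ...   | inj₂ (_ , hub∈ , inj₁ pendant₁-hub) = core-nonempty 2F hub∈

    gadget-nonempty : ∀ i k → member p (gadget i k) ≡ true → 1 ≤ ∣ Vec.lookup (gadgets p) i ∣
    gadget-nonempty i = lookup-true⇒1≤∣p∣ (Vec.lookup (gadgets p) i)

    -- The same argument with `mid₀` and `mid₁`, whose neighbours all lie in their own 4-cycle.
    1≤gadget : ∀ i → 1 ≤ ∣ Vec.lookup (gadgets p) i ∣
    1≤gadget i with member p (mid₀ i) in e₂ | member p (mid₁ i) in e₃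
    ... | true  | _     = gadget-nonempty i 2F e₂
    ... | false | true  = gadget-nonempty i 3F e₃
    ... | false | false with almostLinked (mid₀ i) (mid₁ i) (λ ()) e₂ e₃
    ...   | inj₁ (_ , pos∈ , inj₂ (pos-mid₀ _)) = gadget-nonempty i 0F pos∈
    ...   | inj₁ (_ , neg∈ , inj₂ (neg-mid₀ _)) = gadget-nonempty i 1F neg∈
    ...   | inj₂ (_ , pos∈ , inj₂ (pos-mid₁ _)) = gadget-nonempty i 0F pos∈
    ...   | inj₂ (_ , neg∈ , inj₂ (neg-mid₁ _)) = gadget-nonempty i 1F neg∈

    m≤gadgets : m ≤ ∣ Vec.concat (gadgets p) ∣
    m≤gadgets = m≤∣concat∣ (gadgets p) 1≤gadget

    -- The surplus over `1 + m` is kept because it is used twice: it is positive for dominating sets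
    -- of `G` and vanishes for sets of size `1 + m`.
    bound : (1 + m) + (∣ top p ∣ + ∣ tops p ∣) ≤ ∣ assemble p ∣
    bound = begin
      (1 + m) + (∣ top p ∣ + ∣ tops p ∣)
        ≤⟨ +-monoˡ-≤ _ (+-mono-≤ 1≤core m≤gadgets) ⟩
      (∣ core p ∣ + ∣ Vec.concat (gadgets p) ∣) + (∣ top p ∣ + ∣ tops p ∣)
        ≡⟨ interchange +-commutativeSemigroup (∣ core p ∣) _ _ _ ⟩
      (∣ core p ∣ + ∣ top p ∣) + (∣ Vec.concat (gadgets p) ∣ + ∣ tops p ∣)
        ≡⟨ ∣assemble∣ p ⟨
      ∣ assemble p ∣ ∎
      where open ≤-Reasoning

    module Tight (tight : ∣ assemble p ∣ ≤ 1 + m) where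

      no-tops : ∣ top p ∣ + ∣ tops p ∣ ≡ 0
      no-tops = n≤0⇒n≡0 (+-cancelˡ-≤ (1 + m) _ 0
        (≤-trans bound (≤-trans tight (≤-reflexive (sym (+-identityʳ (1 + m)))))))

      gadgets≤m : ∣ Vec.concat (gadgets p) ∣ ≤ m
      gadgets≤m = s≤s⁻¹ (begin
        1 + ∣ Vec.concat (gadgets p) ∣
          ≤⟨ +-mono-≤ (≤-trans 1≤core (m≤m+n ∣ core p ∣ _)) (m≤m+n _ ∣ tops p ∣) ⟩
        (∣ core p ∣ + ∣ top p ∣) + (∣ Vec.concat (gadgets p) ∣ + ∣ tops p ∣)
          ≡⟨ ∣assemble∣ p ⟨
        ∣ assemble p ∣
          ≤⟨ tight ⟩
        1 + m ∎)
        where open ≤-Reasoning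

      apex∉ : member p apex ≡ false
      apex∉ = trans (lookup-++ʳ (core p) (top p) 0F)
                    (∣p∣≡0⇒lookup-false (top p) 0F (m+n≡0⇒m≡0 ∣ top p ∣ no-tops))

      clause∉ : ∀ j → member p (clause j) ≡ false
      clause∉ j = ∣p∣≡0⇒lookup-false (tops p) j (m+n≡0⇒n≡0 ∣ top p ∣ no-tops)

      assignment : Fin m → Bool
      assignment i = member p (pos i)

      -- A tight set has a single vertex in each gadget, so `neg i` excludes `pos i`. A gadget
      -- represented by a middle vertex reads as `false`.
      neg⇒false : ∀ i → member p (neg i) ≡ true → assignment i ≡ false
      neg⇒false i = at-most-one (Vec.lookup (gadgets p) i)
        (∣concat∣≤m⇒singletons (gadgets p) 1≤gadget gadgets≤m i)
        where
        at-most-one : (g : Subset 4) → ∣ g ∣ ≤ 1 → Vec.lookup g 1F ≡ true → Vec.lookup g 0F ≡ false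
        at-most-one (false ∷ _)        _        _ = refl
        at-most-one (true ∷ true ∷ _) (s≤s ()) _

      -- The clause is paired with the apex. All neighbours of the apex are clauses, hence outside
      -- the set, so it is the clause that has a neighbour in the set; not being the apex, this
      -- neighbour is a literal.
      clause-satisfied : ∀ j → VecAny.Any (λ (sign , i) → assignment i ≡ sign)
                                          (lookup (clauses φ) j)
      clause-satisfied j with almostLinked apex (clause j) (λ ()) apex∉ (clause∉ j)
      ... | inj₁ (clause k , k∈ , _) with () ← trans (sym (clause∉ k)) k∈
      ... | inj₁ (inj₁ _ , _ , inj₁ ())
      ... | inj₁ (inj₁ _ , _ , inj₂ ())
      ... | inj₁ (gadget _ _ , _ , inj₁ ())
      ... | inj₁ (gadget _ _ , _ , inj₂ ())
      ... | inj₂ (_ , apex∈ , inj₂ (apex-clause _)) with () ← trans (sym apex∉) apex∈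
      ... | inj₂ (_ , pos∈ , inj₂ (pos-clause _ x∈c)) = Vec.lose x∈c pos∈
      ... | inj₂ (_ , neg∈ , inj₂ (neg-clause _ x∈c)) = Vec.lose x∈c (neg⇒false _ neg∈)

      satisfiable : Satisfiable φ
      satisfiable = assignment , All.tabulate (λ c∈ →
        subst (VecAny.Any _) (sym (lookup-index c∈)) (clause-satisfied (index c∈)))

  almostDominating⇒1+m≤ : ∀ D → AlmostDominating G D → 1 + m ≤ ∣ D ∣
  almostDominating⇒1+m≤ D almost with p , refl ← assemble-surjective D =
    ≤-trans (m≤m+n (1 + m) _) (LowerBound.bound p almost)

  -- In `G` itself the apex is not exempt: it or one of the clauses is in `D`, which makes the
  -- surplus positive.
  dominating⇒2+m≤ : ∀ D → Dominating G D → 2 + m ≤ ∣ D ∣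
  dominating⇒2+m≤ D dom with p , refl ← assemble-surjective D =
    ≤-trans (≤-reflexive (+-comm 1 (1 + m)))
      (≤-trans (+-monoʳ-≤ (1 + m) 1≤tops)
        (LowerBound.bound p (dominating⇒almostDominating G dom)))
    where
    1≤tops : 1 ≤ ∣ top p ∣ + ∣ tops p ∣
    1≤tops with member p apex in e
    ... | true  = ≤-trans
      (lookup-true⇒1≤∣p∣ (top p) 0F (trans (sym (lookup-++ʳ (core p) (top p) 0F)) e)) (m≤m+n _ _)
    ... | false with neighbour⇒linkedTo p apex (dom (code apex) (non-member⇒∉ p apex e))
    ...   | _ , j∈ , inj₁ (apex-clause j) =
      ≤-trans (lookup-true⇒1≤∣p∣ (tops p) j j∈) (m≤n+m _ ∣ top p ∣)

  almostDominating⇒satisfiable : ∀ D → AlmostDominating G D → ∣ D ∣ ≤ 1 + m → Satisfiable φ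
  almostDominating⇒satisfiable D almost tight with p , refl ← assemble-surjective D =
    LowerBound.Tight.satisfiable p almost tight

  -- Dominating sets from assignments

  choice : Bool → Subset 4
  choice b = b ∷ not b ∷ false ∷ false ∷ []

  -- `d` decides whether the apex is included: `true` gives the optimum for `G`, `false` the smaller
  -- set for the graph with the new edge.
  chosen : (Fin m → Bool) → Bool → Parts
  chosen τ d = parts (false ∷ false ∷ true ∷ []) (d ∷ []) (Vec.tabulate (choice ∘ τ)) ⊥

  ∣chosen∣ : ∀ τ d → ∣ assemble (chosen τ d) ∣ ≡ (1 + ∣ d ∷ [] ∣) + m
  ∣chosen∣ τ d = trans (∣assemble∣ (chosen τ d)) (cong ((1 + ∣ d ∷ [] ∣) +_)
    (trans (cong₂ _+_ (∣concat∣-singletons (Vec.tabulate (choice ∘ τ)) singleton) (∣⊥∣≡0 l))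
           (+-identityʳ m)))
    where
    ∣choice∣ : ∀ b → ∣ choice b ∣ ≡ 1
    ∣choice∣ true  = refl
    ∣choice∣ false = refl
    singleton : ∀ i → ∣ Vec.lookup (Vec.tabulate (choice ∘ τ)) i ∣ ≡ 1
    singleton i rewrite lookup∘tabulate (choice ∘ τ) i = ∣choice∣ (τ i)

  member-pos : ∀ τ d i → member (chosen τ d) (pos i) ≡ τ i
  member-pos τ d i rewrite lookup∘tabulate (choice ∘ τ) i = refl

  member-neg : ∀ τ d i → member (chosen τ d) (neg i) ≡ not (τ i)
  member-neg τ d i rewrite lookup∘tabulate (choice ∘ τ) i = refl

  member-literal : ∀ τ d s i → τ i ≡ s → member (chosen τ d) (literal (s , i)) ≡ true
  member-literal τ d true  i eq = trans (member-pos τ d i) eq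
  member-literal τ d false i eq = trans (member-neg τ d i) (cong not eq)

  -- One statement for both graphs: `F` is empty and the apex is chosen, or `F` joins the hub to the
  -- apex and `τ` satisfies the clauses.
  chosen-dominating : ∀ τ d F o →
    d ≡ true ⊎ (code hub , code apex) List.∈ F →
    (∀ j → d ≡ true ⊎ VecAny.Any (λ (sign , i) → τ i ≡ sign) (lookup (clauses φ) j)) →
    Dominating (addEdges G F o) (assemble (chosen τ d))
  chosen-dominating τ d F o apex-ok clause-ok v v∉D =
    subst (HasNeighbourIn H D) (code-decode v)
      (dominated (decode v) (v∉D ∘ subst (_∈ D) (code-decode v)))
    where
    H = addEdges G F o
    D = assemble (chosen τ d)

    by : ∀ {a} b → member (chosen τ d) b ≡ true → Linked a b → HasNeighbourIn H D (code a)
    by b b∈ lk = code b , member⇒∈ (chosen τ d) b b∈ ,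
      Sum.map (∈-++⁺ʳ F) (∈-++⁺ʳ F) (linked⇒adj lk)

    dominated : ∀ a → code a ∉ D → HasNeighbourIn H D (code a)
    dominated pendant₀ _  = by hub refl (inj₁ pendant₀-hub)
    dominated pendant₁ _  = by hub refl (inj₁ pendant₁-hub)
    dominated hub      ∉D = contradiction (member⇒∈ (chosen τ d) hub refl) ∉D
    dominated apex     ∉D = Sum.[_,_]′
      (λ d≡true → contradiction (member⇒∈ (chosen τ d) apex d≡true) ∉D)
      (λ e∈F → code hub , member⇒∈ (chosen τ d) hub refl , inj₂ (∈-++⁺ˡ e∈F)) apex-ok
    dominated (pos i)  _ = by hub refl (inj₂ (hub-pos i))
    dominated (neg i)  _ = by hub refl (inj₂ (hub-neg i))
    dominated (mid₀ i) _ with τ i in eq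
    ... | true  = by (pos i) (member-literal τ d true i eq) (inj₂ (pos-mid₀ i))
    ... | false = by (neg i) (member-literal τ d false i eq) (inj₂ (neg-mid₀ i))
    dominated (mid₁ i) _ with τ i in eq
    ... | true  = by (pos i) (member-literal τ d true i eq) (inj₂ (pos-mid₁ i))
    ... | false = by (neg i) (member-literal τ d false i eq) (inj₂ (neg-mid₁ i))
    dominated (clause j) _ with clause-ok j
    ... | inj₁ d≡true = by apex d≡true (inj₂ (apex-clause j))
    ... | inj₂ sat  with Vec.find sat
    ...   | x , x∈c , eq =
      by (literal x) (member-literal τ d _ _ eq) (inj₂ (literal-clause j x∈c))

  -- The domination number and correctness of the reduction

  γ-G : IsDominationNumber G (2 + m)
  γ-G = (assemble (chosen τ true) ,
         chosen-dominating τ true [] [] (inj₁ refl) (λ _ → inj₁ refl) , ∣chosen∣ τ true) ,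
        λ { _ (D , dom , refl) → dominating⇒2+m≤ D dom }
    where
    τ : Fin m → Bool
    -- An arbitrary assignment: the chosen apex dominates all clauses.
    τ _ = true

  added : List (Fin (n G) × Fin (n G))
  added = (code hub , code apex) ∷ []

  satisfiable⇒reinforcing : Satisfiable φ → Reinforcing G added
  satisfiable⇒reinforcing (τ , sat) = record
    { F-ordered  = ordered-added
    ; F-distinct = [] ∷ []
    ; F-new      = new ∷ []
    ; γ-old      = 2 + m
    ; γ-new      = 1 + m
    ; is-γ-old   = γ-G
    ; is-γ-new   =
        (assemble (chosen τ false) ,
         chosen-dominating τ false added ordered-added (inj₂ (here refl))
           (λ j → inj₂ (All.lookup sat (∈-lookup j))) ,
         ∣chosen∣ τ false) ,
        λ { _ (D , dom , refl) →
            almostDominating⇒1+m≤ D (addEdge-almostDominating G _ ordered-added dom) }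
    ; decreases  = ≤-refl
    }
    where
    ordered-added = s≤s (s≤s (s≤s z≤n)) ∷ []
    new : ¬ Adj G (code hub) (code apex)
    new adj with adj-code⇒linked {hub} adj
    ... | inj₁ ()
    ... | inj₂ ()

  -- Adding no edge leaves adjacency definitionally unchanged, so a new optimum would undercut the
  -- old one.
  reinforcing⇒1≤length : ∀ F → Reinforcing G F → 1 ≤ length F
  reinforcing⇒1≤length (_ ∷ _) _ = s≤s z≤n
  reinforcing⇒1≤length []
    record { is-γ-old = _ , least ; is-γ-new = (D , dom , eq) , _ ; decreases = dec } =
    contradiction (≤-trans dec (least _ (D , dom , eq))) (<-irrefl refl)

  reinforcing-edge⇒satisfiable : ∀ e → Reinforcing G (e ∷ []) → Satisfiable φ
  reinforcing-edge⇒satisfiable e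
    record { F-ordered = o ; is-γ-old = _ , least ; is-γ-new = (D , dom , refl) , _
           ; decreases = dec } =
    almostDominating⇒satisfiable D (addEdge-almostDominating G e o dom)
      -- The old domination number is at most `2 + m`, and the new one is smaller.
      (s≤s⁻¹ (≤-trans dec (least _ (proj₁ γ-G))))

  reduction-correct : Satisfiable φ ⇔ ReinforcementNumber≤ 1 G
  reduction-correct = mk⇔ to from
    where
    to : Satisfiable φ → ReinforcementNumber≤ 1 G
    to sat = [ 1 ] ,
      ((added , satisfiable⇒reinforcing sat , refl) ,
       λ { _ (F , reinf , refl) → reinforcing⇒1≤length F reinf }) ,
      [ ≤-refl ]

    from : ReinforcementNumber≤ 1 G → Satisfiable φ
    from (_ , ((e ∷ [] , reinf , refl) , _) , [ _ ]) = reinforcing-edge⇒satisfiable e reinf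
    from (_ , (([] , reinf , refl) , _) , [ _ ]) =
      contradiction (reinforcing⇒1≤length [] reinf) λ ()
    from (_ , ((_ ∷ _ ∷ _ , _ , refl) , _) , [ s≤s () ])

-- The reduction as a program

inputAt : List Cell → List Bool → Tape
inputAt ls []       = tape ls nothing []
inputAt ls (b ∷ bs) = tape ls (just b) (map just bs)

-- The head stands on the blank just left of the string, where the next bit goes.
outputOf : List Bool → Tape
outputOf bs = tape [] nothing (map just bs)

ones : ℕ → List Cell
ones k = replicate k (just true) ++ nothing ∷ []

-- The head waits on the blank before the marks, which becomes a mark when the counter grows. The
-- blank closing `ones` is the cell where a pass over the marks turns round.
counterOf : ℕ → Tape
counterOf k = tape [] nothing (ones k)

record Memory : Set where
  constructor ⟨_,_,_⟩
  field
    unread  : List Bool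
    written : List Bool
    counter : ℕ

tapes : List Cell → Memory → Vec Tape 3
tapes ls ⟨ i , o , k ⟩ = inputAt ls i ∷ outputOf o ∷ counterOf k ∷ []

infix 3 _⊢_⇒[_]_

-- The input already read is quantified away, since the head of that tape never moves back.
record _⊢_⇒[_]_ (p : Program 3) (s : Memory) (t : ℕ) (s′ : Memory) : Set where
  constructor execution
  field
    execute : ∀ ls → ∃[ ls′ ] Runs p (tapes ls s) t (tapes ls′ s′)

open _⊢_⇒[_]_

infixr 5 _⊢⨾_

_⊢⨾_ : ∀ {p q s t s′ u s″} → p ⊢ s ⇒[ t ] s′ → q ⊢ s′ ⇒[ u ] s″ →
       (p ⨾ q) ⊢ s ⇒[ t + u ] s″
(r ⊢⨾ r′) .execute ls =
  let ls′ , run  = execute r ls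
      ls″ , run′ = execute r′ ls′
  in ls″ , runs-⨾ run run′

weaken : ∀ {p s t u s′} → t ≤ u → p ⊢ s ⇒[ t ] s′ → p ⊢ s ⇒[ u ] s′
weaken t≤u r .execute ls with ls′ , v , v≤t , run ← execute r ls = ls′ , v , ≤-trans v≤t t≤u , run

-- Unary numbers and encoded lists both continue with `true` and end with `false`, so this test
-- governs every loop over the input; it also tells the sign of a literal.
readsTrue : Test 3
readsTrue (just true ∷ _) = true
readsTrue _               = false

⊢loop-end : ∀ {p i o k} → while readsTrue p ⊢ ⟨ false ∷ i , o , k ⟩ ⇒[ 1 ] ⟨ false ∷ i , o , k ⟩
⊢loop-end .execute ls = ls , runs-while-false refl

⊢loop-step : ∀ {p i o k t s u s′} → p ⊢ ⟨ true ∷ i , o , k ⟩ ⇒[ t ] s →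
             while readsTrue p ⊢ s ⇒[ u ] s′ →
             while readsTrue p ⊢ ⟨ true ∷ i , o , k ⟩ ⇒[ suc (t + u) ] s′
⊢loop-step r r′ .execute ls =
  let ls′ , run  = execute r ls
      ls″ , run′ = execute r′ ls′
  in ls″ , runs-while-true refl run run′

emit : Bool → Program 3
emit b = instr λ { (c ∷ _ ∷ c′ ∷ []) → (c , stay) ∷ (just b , left) ∷ (c′ , stay) ∷ [] }

⊢emit : ∀ b {i o k} → emit b ⊢ ⟨ i , o , k ⟩ ⇒[ 1 ] ⟨ i , b ∷ o , k ⟩
⊢emit b .execute ls = ls , runs-instr _ _

increment : Program 3
increment = instr λ { (c ∷ c′ ∷ _ ∷ []) → (c , stay) ∷ (c′ , stay) ∷ (just true , left) ∷ [] }

⊢increment : ∀ {i o k} → increment ⊢ ⟨ i , o , k ⟩ ⇒[ 1 ] ⟨ i , o , suc k ⟩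
⊢increment .execute ls = ls , runs-instr _ _

advance : Program 3
advance = instr λ { (c ∷ c′ ∷ c″ ∷ []) → (c , right) ∷ (c′ , stay) ∷ (c″ , stay) ∷ [] }

⊢advance : ∀ {b i o k} → advance ⊢ ⟨ b ∷ i , o , k ⟩ ⇒[ 1 ] ⟨ i , o , k ⟩
⊢advance {b} {[]}    .execute ls = just b ∷ ls , runs-instr _ _
⊢advance {b} {_ ∷ _} .execute ls = just b ∷ ls , runs-instr _ _

skip : Program 3
skip = instr idle

⊢skip : ∀ {s} → skip ⊢ s ⇒[ 1 ] s
⊢skip .execute ls = ls , runs-instr _ _

-- The output grows to the left, hence the last bit comes first.
emitAll : List Bool → Program 3
emitAll []       = skip
emitAll (b ∷ bs) = emitAll bs ⨾ emit b

emitAllTime : List Bool → ℕ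
emitAllTime []       = 1
emitAllTime (_ ∷ bs) = emitAllTime bs + 1

⊢emitAll : ∀ bs {i o k} → emitAll bs ⊢ ⟨ i , o , k ⟩ ⇒[ emitAllTime bs ] ⟨ i , bs ++ o , k ⟩
⊢emitAll []       = ⊢skip
⊢emitAll (b ∷ bs) = ⊢emitAll bs ⊢⨾ ⊢emit b

moveCounter : Move → Program 3
moveCounter d = instr λ { (c ∷ c′ ∷ c″ ∷ []) → (c , stay) ∷ (c′ , stay) ∷ (c″ , d) ∷ [] }

emitTrueAndMove : Program 3
emitTrueAndMove =
  instr λ { (c ∷ _ ∷ c″ ∷ []) → (c , stay) ∷ (just true , left) ∷ (c″ , right) ∷ [] }

counterTrue : Test 3
counterTrue (_ ∷ _ ∷ just true ∷ []) = true
counterTrue _                        = false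

-- The pass to the right copies the marks one by one; the pass to the left only restores the
-- position of the head.
emitCounter : Program 3
emitCounter = moveCounter right ⨾ while counterTrue emitTrueAndMove ⨾
              moveCounter left ⨾ while counterTrue (moveCounter left)

replicate-++-∷ : ∀ {A : Set} k (x : A) {xs} → replicate k x ++ x ∷ xs ≡ x ∷ replicate k x ++ xs
replicate-++-∷ zero    x = refl
replicate-++-∷ (suc k) x = cong (x ∷_) (replicate-++-∷ k x)

-- The counter tape with j marks to the left of the head and k marks from the
-- head on, before and after the head has turned round.
forth back : ℕ → ℕ → Tape
forth j zero    = tape (ones j) nothing []
forth j (suc k) = tape (ones j) (just true) (ones k)
back zero    k = counterOf k
back (suc j) k = tape (ones j) (just true) (ones k)

runs-forth : ∀ t j k o →
  Runs (while counterTrue emitTrueAndMove) (t ∷ outputOf o ∷ forth j k ∷ []) (k * 2 + 1)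
       (t ∷ outputOf (replicate k true ++ o) ∷ forth (k + j) 0 ∷ [])
runs-forth t j zero    o = runs-while-false refl
runs-forth t j (suc k) o = runs-while-true refl (runs-instr _ _)
  (subst (λ c → Runs loop (t ∷ outputOf (true ∷ o) ∷ c ∷ []) (k * 2 + 1) end) (turn k)
    (subst₂ (λ o′ j′ → Runs loop (t ∷ outputOf (true ∷ o) ∷ forth (suc j) k ∷ []) (k * 2 + 1)
                                 (t ∷ outputOf o′ ∷ forth j′ 0 ∷ []))
      (replicate-++-∷ k true) (+-suc k j) (runs-forth t (suc j) k (true ∷ o))))
  where
  loop : Program 3
  loop = while counterTrue emitTrueAndMove
  end : Vec Tape 3
  end = t ∷ outputOf (true ∷ replicate k true ++ o) ∷ forth (suc k + j) 0 ∷ []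
  -- Computes only once it is known whether a mark follows.
  turn : ∀ k → forth (suc j) k ≡ move right (forth j (suc k))
  turn zero    = refl
  turn (suc k) = refl

runs-back : ∀ t t′ j k →
  Runs (while counterTrue (moveCounter left)) (t ∷ t′ ∷ back j k ∷ []) (j * 2 + 1)
       (t ∷ t′ ∷ counterOf (j + k) ∷ [])
runs-back t t′ zero    k = runs-while-false refl
runs-back t t′ (suc j) k = runs-while-true refl (runs-instr _ _)
  (subst₂ (λ c k′ → Runs (while counterTrue (moveCounter left))
      (t ∷ t′ ∷ c ∷ []) (j * 2 + 1) (t ∷ t′ ∷ counterOf k′ ∷ []))
    (turn j) (+-suc j k) (runs-back t t′ j (suc k)))
  where
  turn : ∀ j → back j (suc k) ≡ move left (back (suc j) k)
  turn zero    = refl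
  turn (suc j) = refl

emitCounterTime : ℕ → ℕ
emitCounterTime k = 1 + (k * 2 + 1 + (1 + (k * 2 + 1)))

⊢emitCounter : ∀ {i o k} →
  emitCounter ⊢ ⟨ i , o , k ⟩ ⇒[ emitCounterTime k ] ⟨ i , replicate k true ++ o , k ⟩
⊢emitCounter {i} {o} {k} .execute ls = ls ,
  runs-⨾ (start k) (runs-⨾ forward (runs-⨾ (turn k) backward))
  where
  t  = inputAt ls i
  t′ = outputOf (replicate k true ++ o)
  forward : Runs (while counterTrue emitTrueAndMove)
                 (t ∷ outputOf o ∷ forth 0 k ∷ []) (k * 2 + 1) (t ∷ t′ ∷ forth k 0 ∷ [])
  forward = subst (λ j → Runs (while counterTrue emitTrueAndMove)
      (t ∷ outputOf o ∷ forth 0 k ∷ []) (k * 2 + 1) (t ∷ t′ ∷ forth j 0 ∷ []))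
    (+-identityʳ k) (runs-forth t 0 k o)
  backward : Runs (while counterTrue (moveCounter left))
                  (t ∷ t′ ∷ back k 0 ∷ []) (k * 2 + 1) (t ∷ t′ ∷ counterOf k ∷ [])
  backward = subst (λ j → Runs (while counterTrue (moveCounter left))
      (t ∷ t′ ∷ back k 0 ∷ []) (k * 2 + 1) (t ∷ t′ ∷ counterOf j ∷ []))
    (+-identityʳ k) (runs-back t t′ k 0)
  start : ∀ k → Runs (moveCounter right) (t ∷ outputOf o ∷ counterOf k ∷ []) 1
                     (t ∷ outputOf o ∷ forth 0 k ∷ [])
  start zero    = runs-instr _ _
  start (suc k) = runs-instr _ _
  turn : ∀ j → Runs (moveCounter left) (t ∷ t′ ∷ forth j 0 ∷ []) 1
                    (t ∷ t′ ∷ back j 0 ∷ [])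
  turn zero    = runs-instr _ _
  turn (suc j) = runs-instr _ _

-- Writing the edges

ones-unary : ∀ p q {o} → replicate p true ++ replicate q true ++ false ∷ o ≡ unary (p + q) ++ o
ones-unary (suc p) q       = cong (true ∷_) (ones-unary p q)
ones-unary zero    zero    = refl
ones-unary zero    (suc q) = cong (true ∷_) (ones-unary zero q)

-- A vertex number is either a constant or a constant above the counter, except for the literals
-- read from a clause, which `emitLiteral` handles.
data Endpoint : Set where
  fixed above : ℕ → Endpoint

value : ℕ → Endpoint → ℕ
value k (fixed c) = c
value k (above c) = c + k

emitEndpoint : Endpoint → Program 3
emitEndpoint (fixed c) = emitAll (unary c)
emitEndpoint (above c) = emit false ⨾ emitCounter ⨾ emitAll (replicate c true)

-- `B` bounds the counter, so the estimate is the same at every stage of the run.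
endpointTime : ℕ → Endpoint → ℕ
endpointTime B (fixed c) = emitAllTime (unary c)
endpointTime B (above c) = 1 + (emitCounterTime B + emitAllTime (replicate c true))

emitCounterTime-mono : ∀ {k B} → k ≤ B → emitCounterTime k ≤ emitCounterTime B
emitCounterTime-mono k≤B = s≤s (+-mono-≤ pass (s≤s pass))
  where pass = +-monoˡ-≤ 1 (*-monoˡ-≤ 2 k≤B)

⊢emitEndpoint : ∀ {B} e {i o k} → k ≤ B →
  emitEndpoint e ⊢ ⟨ i , o , k ⟩ ⇒[ endpointTime B e ] ⟨ i , unary (value k e) ++ o , k ⟩
⊢emitEndpoint (fixed c) _ = ⊢emitAll (unary c)
⊢emitEndpoint (above c) {i} {o} {k} k≤B =
  subst (λ o′ → _ ⊢ _ ⇒[ _ ] ⟨ i , o′ , k ⟩) (ones-unary c k)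
    (⊢emit false ⊢⨾ weaken (emitCounterTime-mono k≤B) ⊢emitCounter ⊢⨾ ⊢emitAll (replicate c true))

-- From right to left: the second endpoint, the first, and the `true` that announces a list entry.
emitEdge : Endpoint → Endpoint → Program 3
emitEdge e f = emitEndpoint f ⨾ emitEndpoint e ⨾ emit true

edgeTime : ℕ → Endpoint → Endpoint → ℕ
edgeTime B e f = endpointTime B f + (endpointTime B e + 1)

-- The counter is at `pos`, so `neg`, `mid₀` and `mid₁` lie 1, 2 and 3 above it; `fixed 2` is the
-- hub. The edges come in the reverse order of `gadgetEdges`, and four increments lead to the next
-- gadget.
gadgetStep : Program 3
gadgetStep =
  emitEdge (fixed 2) (above 1) ⨾ emitEdge (fixed 2) (above 0) ⨾
  emitEdge (above 1) (above 3) ⨾ emitEdge (above 0) (above 3) ⨾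
  emitEdge (above 1) (above 2) ⨾ emitEdge (above 0) (above 2) ⨾
  increment ⨾ increment ⨾ increment ⨾ increment ⨾ advance

gadgetTime : ℕ → ℕ
gadgetTime B =
  edgeTime B (fixed 2) (above 1) + (edgeTime B (fixed 2) (above 0) +
  (edgeTime B (above 1) (above 3) + (edgeTime B (above 0) (above 3) +
  (edgeTime B (above 1) (above 2) + (edgeTime B (above 0) (above 2) + 5)))))

module _ {m l : ℕ} where
  open Layout m l

  encodeEdges : List (Vertex m l × Vertex m l) → List Bool
  encodeEdges = encodeList (λ (a , b) → unary (number a) ++ unary (number b))

  ⊢emitEdge : ∀ {B} e f a b es {i k} → k ≤ B → value k e ≡ number a → value k f ≡ number b →
    emitEdge e f ⊢ ⟨ i , encodeEdges es , k ⟩ ⇒[ edgeTime B e f ]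
                   ⟨ i , encodeEdges ((a , b) ∷ es) , k ⟩
  ⊢emitEdge e f a b es {i} {k} k≤B e≡a f≡b =
    subst (λ o → _ ⊢ _ ⇒[ _ ] ⟨ i , true ∷ o , k ⟩)
      (trans (cong₂ (λ x y → unary x ++ unary y ++ encodeEdges es) e≡a f≡b)
             (sym (++-assoc (unary (number a)) (unary (number b)) (encodeEdges es))))
      (⊢emitEndpoint f k≤B ⊢⨾ ⊢emitEndpoint e k≤B ⊢⨾ ⊢emit true)

  ⊢gadgetStep : ∀ {B i es} v → 4 + toℕ v * 4 ≤ B →
    gadgetStep ⊢ ⟨ true ∷ i , encodeEdges es , 4 + toℕ v * 4 ⟩ ⇒[ gadgetTime B ]
                 ⟨ i , encodeEdges (gadgetEdges v ++ es) , 4 + suc (toℕ v) * 4 ⟩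
  ⊢gadgetStep {es = es} v k≤B =
    ⊢emitEdge (fixed 2) (above 1) hub (neg v) es k≤B refl (num 1F) ⊢⨾
    ⊢emitEdge (fixed 2) (above 0) hub (pos v) es₁ k≤B refl (num 0F) ⊢⨾
    ⊢emitEdge (above 1) (above 3) (neg v) (mid₁ v) es₂ k≤B (num 1F) (num 3F) ⊢⨾
    ⊢emitEdge (above 0) (above 3) (pos v) (mid₁ v) es₃ k≤B (num 0F) (num 3F) ⊢⨾
    ⊢emitEdge (above 1) (above 2) (neg v) (mid₀ v) es₄ k≤B (num 1F) (num 2F) ⊢⨾
    ⊢emitEdge (above 0) (above 2) (pos v) (mid₀ v) es₅ k≤B (num 0F) (num 2F) ⊢⨾
    ⊢increment ⊢⨾ ⊢increment ⊢⨾ ⊢increment ⊢⨾ ⊢increment ⊢⨾ ⊢advance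
    where
    num : ∀ b → toℕ b + (4 + toℕ v * 4) ≡ number (gadget v b)
    num b = trans (+-comm (toℕ b) _) (sym (number-gadget v b))
    es₁ = (hub   , neg v)  ∷ es
    es₂ = (hub   , pos v)  ∷ es₁
    es₃ = (neg v , mid₁ v) ∷ es₂
    es₄ = (pos v , mid₁ v) ∷ es₃
    es₅ = (neg v , mid₀ v) ∷ es₄

  -- Loop invariant: `v` variables are done, `r` remain, and `ι` numbers the remaining ones from `v`
  -- on.
  ⊢variables : ∀ {B} r ι {v i es} → 4 + m * 4 ≤ B → v + r ≡ m → (∀ w → toℕ (ι w) ≡ v + toℕ w) →
    while readsTrue gadgetStep ⊢
      ⟨ unary r ++ i , encodeEdges es , 4 + v * 4 ⟩ ⇒[ r * suc (gadgetTime B) + 1 ]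
      ⟨ false ∷ i , encodeEdges (variableEdges r ι es) , 4 + m * 4 ⟩
  ⊢variables zero ι {v} _ refl _ rewrite +-identityʳ v = ⊢loop-end
  ⊢variables {B} (suc r) ι {v} {i} {es} B≥ v+r≡m ι≡ =
    weaken (≤-reflexive (cong suc (sym (+-assoc (gadgetTime B) _ 1))))
      (⊢loop-step first
        (⊢variables r (ι ∘ suc) {suc v} B≥ (trans (sym (+-suc v r)) v+r≡m)
          (λ w → trans (ι≡ (suc w)) (+-suc v (toℕ w)))))
    where
    ι0≡v : toℕ (ι zero) ≡ v
    ι0≡v = trans (ι≡ zero) (+-identityʳ v)
    first : gadgetStep ⊢ ⟨ true ∷ unary r ++ i , encodeEdges es , 4 + v * 4 ⟩ ⇒[ gadgetTime B ]
              ⟨ unary r ++ i , encodeEdges (gadgetEdges (ι zero) ++ es) , 4 + suc v * 4 ⟩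
    first = subst (λ v → gadgetStep ⊢ ⟨ _ , encodeEdges es , 4 + v * 4 ⟩ ⇒[ _ ]
                             ⟨ _ , encodeEdges (gadgetEdges (ι zero) ++ es) , 4 + suc v * 4 ⟩) ι0≡v
      (⊢gadgetStep (ι zero)
        (≤-trans (+-monoʳ-≤ 4 (*-monoˡ-≤ 4 (<⇒≤ (toℕ<n (ι zero))))) B≥))

fourOnes fiveOnes : List Bool
fourOnes = replicate 4 true
fiveOnes = replicate 5 true

emitIndex : Program 3
emitIndex = while readsTrue (emitAll fourOnes ⨾ advance)

-- Each mark takes seven steps: five for the four ones, one to advance and one for the loop test.
⊢emitIndex : ∀ x {i o k} →
  emitIndex ⊢ ⟨ unary x ++ i , o , k ⟩ ⇒[ x * 7 + 1 ]
              ⟨ false ∷ i , replicate (x * 4) true ++ o , k ⟩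
⊢emitIndex zero = ⊢loop-end
⊢emitIndex (suc x) {i} {o} {k} =
  subst (λ o′ → emitIndex ⊢ ⟨ unary (suc x) ++ i , o , k ⟩ ⇒[ suc x * 7 + 1 ]
                            ⟨ false ∷ i , o′ , k ⟩) (slide (x * 4))
    (⊢loop-step (⊢emitAll fourOnes ⊢⨾ ⊢advance) (⊢emitIndex x))
  where
  slide : ∀ y → replicate y true ++ fourOnes ++ o ≡ fourOnes ++ replicate y true ++ o
  slide zero    = refl
  slide (suc y) = cong (true ∷_) (slide y)

-- The literals of variable `i` have the numbers `4 + 4i` and `5 + 4i`. The sign thus contributes
-- four or five ones and each mark of the index four more, which allows translation while reading.
emitLiteral : Program 3
emitLiteral = emit false ⨾ branch readsTrue (emitAll fourOnes) (emitAll fiveOnes) ⨾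
              advance ⨾ emitIndex ⨾ advance

literalTime : ℕ → ℕ
literalTime B = 1 + (7 + (1 + (B * 7 + 1 + 1)))

literalStep : Program 3
literalStep = emitEndpoint (above 0) ⨾ emitLiteral ⨾ emit true

literalStepTime : ℕ → ℕ
literalStepTime B = endpointTime B (above 0) + (literalTime B + 1)

-- An encoded clause has no list markers, so its literals are treated by unrolled code rather than
-- by a loop.
literalSteps : ℕ → Program 3
literalSteps zero    = skip
literalSteps (suc r) = literalStep ⨾ literalSteps r

literalStepsTime : ℕ → ℕ → ℕ
literalStepsTime B zero    = 1
literalStepsTime B (suc r) = literalStepTime B + literalStepsTime B r

-- The counter is at the clause vertex, and `fixed 3` is the apex. The first move skips the list
-- marker of the clause.
clauseStep : Program 3
clauseStep = advance ⨾ emitEdge (fixed 3) (above 0) ⨾ literalSteps 3 ⨾ increment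

clauseTime : ℕ → ℕ
clauseTime B = 1 + (edgeTime B (fixed 3) (above 0) + (literalStepsTime B 3 + 1))

module _ {m l : ℕ} where
  open Layout m l

  ⊢emitLiteral : ∀ {B} x {i o k} → m ≤ B →
    emitLiteral ⊢ ⟨ proj₁ x ∷ unary (toℕ (proj₂ x)) ++ i , o , k ⟩ ⇒[ literalTime B ]
                  ⟨ i , unary (number (literal x)) ++ o , k ⟩
  ⊢emitLiteral {B} (s , v) {i} {o} {k} m≤B =
    subst (λ o′ → emitLiteral ⊢ _ ⇒[ _ ] ⟨ i , o′ , k ⟩) (bits s)
      (⊢emit false ⊢⨾ sign s ⊢⨾ ⊢advance ⊢⨾
       weaken (+-monoˡ-≤ 1 (*-monoˡ-≤ 7 (≤-trans (<⇒≤ (toℕ<n v)) m≤B))) (⊢emitIndex (toℕ v)) ⊢⨾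
       ⊢advance)
    where
    signOnes : Bool → List Bool
    signOnes true  = fourOnes
    signOnes false = fiveOnes

    sign : ∀ s {i o} → branch readsTrue (emitAll fourOnes) (emitAll fiveOnes) ⊢
      ⟨ s ∷ i , o , k ⟩ ⇒[ 7 ] ⟨ s ∷ i , signOnes s ++ o , k ⟩
    sign true  {i} {o} = weaken (n≤1+n 6) (execution λ ls →
      let ls′ , r = execute (⊢emitAll fourOnes {true ∷ i} {o} {k}) ls
      in ls′ , runs-branch-true {ts = tapes ls ⟨ true ∷ i , o , k ⟩} refl r)
    sign false {i} {o} = execution λ ls →
      let ls′ , r = execute (⊢emitAll fiveOnes {false ∷ i} {o} {k}) ls
      in ls′ , runs-branch-false {ts = tapes ls ⟨ false ∷ i , o , k ⟩} refl r

    shift : ∀ y b → y + (4 + b) ≡ 4 + (y + b)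
    shift = solve-∀

    bits : ∀ s → replicate (toℕ v * 4) true ++ signOnes s ++ false ∷ o ≡
                 unary (number (literal (s , v))) ++ o
    bits true = trans (ones-unary (toℕ v * 4) 4 {o})
      (cong (λ x → unary x ++ o) (trans (shift (toℕ v * 4) 0) (sym (number-gadget v 0F))))
    bits false = trans (ones-unary (toℕ v * 4) 5 {o})
      (cong (λ x → unary x ++ o) (trans (shift (toℕ v * 4) 1) (sym (number-gadget v 1F))))

  ⊢literalStep : ∀ {B} x j {es i k} → m ≤ B → k ≤ B → k ≡ number (clause j) →
    literalStep ⊢ ⟨ proj₁ x ∷ unary (toℕ (proj₂ x)) ++ i , encodeEdges es , k ⟩
      ⇒[ literalStepTime B ] ⟨ i , encodeEdges ((literal x , clause j) ∷ es) , k ⟩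
  ⊢literalStep {B} x j {es} {i} {k} m≤B k≤B refl =
    subst (λ o → literalStep ⊢ ⟨ proj₁ x ∷ unary (toℕ (proj₂ x)) ++ i , encodeEdges es , k ⟩
                   ⇒[ literalStepTime B ] ⟨ i , true ∷ o , k ⟩)
      (sym (++-assoc (unary (number (literal x))) (unary (number (clause j))) (encodeEdges es)))
      (⊢emitEndpoint (above 0) k≤B ⊢⨾ ⊢emitLiteral x m≤B ⊢⨾ ⊢emit true)

  ⊢literalSteps : ∀ {B r} (c : Vec (Literal m) r) j {i es k} →
    m ≤ B → k ≤ B → k ≡ number (clause j) →
    literalSteps r ⊢ ⟨ encodeClause c ++ i , encodeEdges es , k ⟩ ⇒[ literalStepsTime B r ]
                     ⟨ i , encodeEdges (literalEdges j c es) , k ⟩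
  ⊢literalSteps []            j _ _ _ = ⊢skip
  ⊢literalSteps (x@(s , v) ∷ c) j {i} {es} m≤B k≤B k≡
    rewrite ++-assoc (unary (toℕ v)) (encodeClause c) i =
    ⊢literalStep x j {es = es} m≤B k≤B k≡ ⊢⨾ ⊢literalSteps c j m≤B k≤B k≡

  -- Loop invariant: `j` clauses are done, and `ι` numbers those in `cs` from `j` on.
  ⊢clauses : ∀ {B} (cs : List (Clause m)) ι {j es} → m ≤ B → 4 + (m * 4 + l) ≤ B →
    j + length cs ≡ l → (∀ w → toℕ (ι w) ≡ j + toℕ w) →
    while readsTrue clauseStep ⊢
      ⟨ encodeList encodeClause cs , encodeEdges es , 4 + (m * 4 + j) ⟩
      ⇒[ length cs * suc (clauseTime B) + 1 ]
      ⟨ false ∷ [] , encodeEdges (clauseEdges cs ι es) , 4 + (m * 4 + l) ⟩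
  ⊢clauses [] ι {j} _ _ refl _ rewrite +-identityʳ j = ⊢loop-end
  ⊢clauses {B} (c ∷ cs) ι {j} {es} m≤B n≤B j+l ι≡ =
    weaken (≤-reflexive (cong suc (sym (+-assoc (clauseTime B) _ 1))))
      (⊢loop-step first
        (⊢clauses cs (ι ∘ suc) m≤B n≤B (trans (sym (+-suc j (length cs))) j+l)
          (λ w → trans (ι≡ (suc w)) (+-suc j (toℕ w)))))
    where
    es₁ = literalEdges (ι zero) c ((apex , clause (ι zero)) ∷ es)
    k≡ : 4 + (m * 4 + j) ≡ number (clause (ι zero))
    k≡ = sym (trans (number-clause (ι zero))
      (cong (λ j → 4 + (m * 4 + j)) (trans (ι≡ zero) (+-identityʳ j))))
    k≤B : 4 + (m * 4 + j) ≤ B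
    k≤B = ≤-trans (+-monoʳ-≤ 4 (+-monoʳ-≤ (m * 4) (≤-trans (m≤m+n j _) (≤-reflexive j+l)))) n≤B
    first : clauseStep ⊢
      ⟨ true ∷ encodeClause c ++ encodeList encodeClause cs , encodeEdges es , 4 + (m * 4 + j) ⟩
      ⇒[ clauseTime B ]
      ⟨ encodeList encodeClause cs ,
        encodeEdges es₁ , 4 + (m * 4 + suc j) ⟩
    first = subst (λ k → clauseStep ⊢
        ⟨ true ∷ encodeClause c ++ encodeList encodeClause cs , encodeEdges es , 4 + (m * 4 + j) ⟩
        ⇒[ clauseTime B ] ⟨ encodeList encodeClause cs , encodeEdges es₁ , k ⟩)
      (cong (4 +_) (sym (+-suc (m * 4) j)))
      (⊢advance ⊢⨾ ⊢emitEdge (fixed 3) (above 0) apex (clause (ι zero)) es k≤B refl k≡ ⊢⨾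
       ⊢literalSteps c (ι zero) {es = (apex , clause (ι zero)) ∷ es} m≤B k≤B k≡ ⊢⨾ ⊢increment)

encodeList-map : ∀ {A B : Set} (enc : B → List Bool) (f : A → B) xs →
                 encodeList enc (map f xs) ≡ encodeList (enc ∘ f) xs
encodeList-map enc f []       = refl
encodeList-map enc f (x ∷ xs) = cong (λ bs → true ∷ enc (f x) ++ bs) (encodeList-map enc f xs)

length≤encodeList : ∀ {A : Set} (enc : A → List Bool) xs → length xs ≤ length (encodeList enc xs)
length≤encodeList enc []       = z≤n
length≤encodeList enc (x ∷ xs) rewrite length-++ (enc x) {encodeList enc xs} =
  s≤s (≤-trans (length≤encodeList enc xs) (m≤n+m _ (length (enc x))))

untilBlank-just : ∀ bs → untilBlank (map just bs) ≡ bs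
untilBlank-just []       = refl
untilBlank-just (b ∷ bs) = cong (b ∷_) (untilBlank-just bs)

-- Turning the counter tape round once leaves the explicit blank that counterOf expects.
prologue : Program 3
prologue = moveCounter right ⨾ moveCounter left

-- The first bit written is the end marker of the edge list; the increments bring the counter to the
-- first gadget.
base : Program 3
base = emit false ⨾ emitEdge (fixed 0) (fixed 2) ⨾ emitEdge (fixed 1) (fixed 2) ⨾
       increment ⨾ increment ⨾ increment ⨾ increment

baseTime : ℕ
baseTime = 1 + (edgeTime 0 (fixed 0) (fixed 2) + (edgeTime 0 (fixed 1) (fixed 2) + 4))

-- `advance` skips the terminator of the number of variables. After the last clause the counter
-- equals the number of vertices, so it is written in front of the edges.
body : Program 3
body = base ⨾ while readsTrue gadgetStep ⨾ advance ⨾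
       while readsTrue clauseStep ⨾ emitEndpoint (above 0)

bodyTime : ℕ → ℕ → ℕ → ℕ
bodyTime B m l = baseTime + (m * suc (gadgetTime B) + 1 +
                 (1 + (l * suc (clauseTime B) + 1 + endpointTime B (above 0))))

-- `output` reads from the head on, which so far stands on the blank before the string.
enterOutput : Program 3
enterOutput =
  instr λ { (c ∷ c′ ∷ c″ ∷ []) → (c , stay) ∷ (c′ , right) ∷ (c″ , stay) ∷ [] }

reductionProgram : Program 3
reductionProgram = prologue ⨾ body ⨾ enterOutput

module _ (φ : Formula) where
  open Reduction φ
  open Layout m l

  ⊢base : ∀ {i} → base ⊢ ⟨ i , [] , 0 ⟩ ⇒[ baseTime ] ⟨ i , encodeEdges baseEdges , 4 ⟩
  ⊢base =
    ⊢emit false ⊢⨾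
    ⊢emitEdge {m} {l} {0} (fixed 0) (fixed 2) pendant₀ hub [] z≤n refl refl ⊢⨾
    ⊢emitEdge {m} {l} {0} (fixed 1) (fixed 2) pendant₁ hub ((pendant₀ , hub) ∷ []) z≤n refl refl ⊢⨾
    ⊢increment ⊢⨾ ⊢increment ⊢⨾ ⊢increment ⊢⨾ ⊢increment

  ⊢body : ∀ {B} → m ≤ B → 4 + (m * 4 + l) ≤ B →
    body ⊢ ⟨ encodeFormula φ , [] , 0 ⟩ ⇒[ bodyTime B m l ] ⟨ false ∷ [] , encodeGraph G , n G ⟩
  ⊢body {B} m≤B n≤B =
    subst (λ o → body ⊢ ⟨ encodeFormula φ , [] , 0 ⟩ ⇒[ bodyTime B m l ]
                        ⟨ false ∷ [] , unary (n G) ++ o , n G ⟩)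
      (sym (encodeList-map _ _ links))
      (⊢base ⊢⨾
       ⊢variables m id {0} {es = baseEdges}
         (≤-trans (+-monoʳ-≤ 4 (m≤m+n (m * 4) l)) n≤B) refl (λ _ → refl) ⊢⨾
       ⊢advance ⊢⨾
       subst (λ k → while readsTrue clauseStep ⊢
           ⟨ encodeList encodeClause (clauses φ) , encodeEdges es , 4 + k ⟩
           ⇒[ l * suc (clauseTime B) + 1 ] ⟨ false ∷ [] , encodeEdges links , n G ⟩)
         (+-identityʳ (m * 4))
         (⊢clauses (clauses φ) id {0} {es} m≤B n≤B refl (λ _ → refl)) ⊢⨾
       ⊢emitEndpoint (above 0) n≤B)
    where
    es = variableEdges m id baseEdges

  -- Bounds on sizes and running time

  L : ℕ
  L = length (encodeFormula φ)

  m≤L : m ≤ L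
  m≤L rewrite length-++ (unary m) {encodeList encodeClause (clauses φ)}
            | length-++ (replicate m true) {false ∷ []} | length-replicate m {true} =
    ≤-trans (m≤m+n m 1) (m≤m+n (m + 1) _)

  l≤L : l ≤ L
  l≤L rewrite length-++ (unary m) {encodeList encodeClause (clauses φ)} =
    ≤-trans (length≤encodeList encodeClause (clauses φ)) (m≤n+m _ (length (unary m)))

-- Bounds the number `4 + 4m + l` of vertices, as `m` and `l` are at most `L`.
counterBound : ℕ → ℕ
counterBound L = L * 5 + 4

totalTime : ℕ → ℕ
totalTime L = 2 + (bodyTime (counterBound L) L L + 1)

emitCounterTime≡ : ∀ B → emitCounterTime B ≡ B * 4 + 4
emitCounterTime≡ = eq
  where
  eq : ∀ B → 1 + (B * 2 + 1 + (1 + (B * 2 + 1))) ≡ B * 4 + 4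
  eq = solve-∀

-- The sum is written out for the ring solver, with `c` standing for `emitCounterTime B`.
gadgetTime≡ : ∀ B → gadgetTime B ≡ B * 40 + 92
gadgetTime≡ B = trans (eq₁ (emitCounterTime B))
  (trans (cong (λ c → c * 10 + 52) (emitCounterTime≡ B)) (eq₂ B))
  where
  eq₁ : ∀ c → (1 + (c + 2) + 5) + ((1 + (c + 1) + 5) +
    ((1 + (c + 4) + (1 + (c + 2) + 1)) + ((1 + (c + 4) + (1 + (c + 1) + 1)) +
    ((1 + (c + 3) + (1 + (c + 2) + 1)) + ((1 + (c + 3) + (1 + (c + 1) + 1)) + 5)))))
    ≡ c * 10 + 52
  eq₁ = solve-∀
  eq₂ : ∀ B → (B * 4 + 4) * 10 + 52 ≡ B * 40 + 92
  eq₂ = solve-∀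

clauseTime≡ : ∀ B → clauseTime B ≡ B * 37 + 69
clauseTime≡ B = trans (eq₁ B (emitCounterTime B))
  (trans (cong (λ c → c * 4 + B * 21 + 53) (emitCounterTime≡ B)) (eq₂ B))
  where
  eq₁ : ∀ b c → let s = 1 + (c + 1) + (1 + (7 + (1 + (b * 7 + 1 + 1))) + 1) in
        1 + ((1 + (c + 1) + 6) + ((s + (s + (s + 1))) + 1)) ≡ c * 4 + b * 21 + 53
  eq₁ = solve-∀
  eq₂ : ∀ B → (B * 4 + 4) * 4 + B * 21 + 53 ≡ B * 37 + 69
  eq₂ = solve-∀

totalTime≡ : ∀ L → totalTime L ≡ L * L * 385 + L * 491 + 48
totalTime≡ L = begin
  totalTime L
    ≡⟨ cong₂ (λ g c → combine-times g c (emitCounterTime B)) (gadgetTime≡ B) (clauseTime≡ B) ⟩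
  combine-times (B * 40 + 92) (B * 37 + 69) (emitCounterTime B)
    ≡⟨ cong (combine-times (B * 40 + 92) (B * 37 + 69)) (emitCounterTime≡ B) ⟩
  combine-times (B * 40 + 92) (B * 37 + 69) (B * 4 + 4)
    ≡⟨ eq₁ L B ⟩
  L * (B * 77 + 163) + B * 4 + 32
    ≡⟨ eq₂ L ⟩
  L * L * 385 + L * 491 + 48 ∎
  where
  open ≡-Reasoning
  B = counterBound L
  combine-times : ℕ → ℕ → ℕ → ℕ
  -- 20 is `baseTime`; `g`, `c` and `e` are the times of a gadget, of a clause and of copying the
  -- counter.
  combine-times g c e = 2 + (20 + (L * suc g + 1 + (1 + (L * suc c + 1 + (1 + (e + 1))))) + 1)
  eq₁ : ∀ L b → 2 + (20 + (L * suc (b * 40 + 92) + 1 +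
                  (1 + (L * suc (b * 37 + 69) + 1 + (1 + (b * 4 + 4 + 1))))) + 1)
                ≡ L * (b * 77 + 163) + b * 4 + 32
  eq₁ = solve-∀
  eq₂ : ∀ L → L * ((L * 5 + 4) * 77 + 163) + (L * 5 + 4) * 4 + 32 ≡ L * L * 385 + L * 491 + 48
  eq₂ = solve-∀

-- Replacing `L` by its square merges the coefficients into 385 + 491 = 876, which also exceeds the
-- constant 48.
totalTime≤ : ∀ L → totalTime L ≤ 876 * L ^ 2 + 876
totalTime≤ L = begin
  totalTime L
    ≡⟨ totalTime≡ L ⟩
  L * L * 385 + L * 491 + 48
    ≤⟨ +-mono-≤ (+-monoʳ-≤ (L * L * 385) (*-monoˡ-≤ 491 (L≤L*L L))) (m≤m+n 48 828) ⟩
  L * L * 385 + L * L * 491 + 876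
    ≡⟨ cong (_+ 876) (*-distribˡ-+ (L * L) 385 491) ⟨
  L * L * 876 + 876
    ≡⟨ cong (λ x → L * x * 876 + 876) (*-identityʳ L) ⟨
  L ^ 2 * 876 + 876
    ≡⟨ cong (_+ 876) (*-comm (L ^ 2) 876) ⟩
  876 * L ^ 2 + 876 ∎
  where
  open ≤-Reasoning
  L≤L*L : ∀ L → L ≤ L * L
  L≤L*L zero    = z≤n
  L≤L*L (suc L) = m≤m+n (suc L) _

bodyTime-mono : ∀ B {m l L} → m ≤ L → l ≤ L → bodyTime B m l ≤ bodyTime B L L
bodyTime-mono B m≤L l≤L = +-monoʳ-≤ baseTime
  (+-mono-≤ (+-monoˡ-≤ 1 (*-monoˡ-≤ (suc (gadgetTime B)) m≤L))
    (s≤s (+-monoˡ-≤ (endpointTime B (above 0))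
      (+-monoˡ-≤ 1 (*-monoˡ-≤ (suc (clauseTime B)) l≤L)))))

inputTape≡inputAt : ∀ bs → inputTape bs ≡ inputAt [] bs
inputTape≡inputAt []      = refl
inputTape≡inputAt (_ ∷ _) = refl

reduction-computes : ∀ φ → ∃[ t ]
  ( Outputs (compile reductionProgram) (encodeFormula φ) (encodeGraph (Reduction.G φ)) t
  × t ≤ 876 * length (encodeFormula φ) ^ 2 + 876)
reduction-computes φ = t ,
  ((inj₂ tt , end) ,
   subst (λ i → HaltsIn (compile reductionProgram) (_ , i ∷ blankTape ∷ blankTape ∷ []) t
                        (inj₂ tt , end))
     (sym (inputTape≡inputAt (encodeFormula φ))) (compile-halts reductionProgram reach) ,
   -- The code starts with a mark, as `G` has at least four vertices, so `move right` computes and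
   -- puts the head on the first bit.
   untilBlank-just (encodeGraph G)) ,
  ≤-trans t≤ (≤-trans
    (+-monoʳ-≤ 2 (+-monoˡ-≤ 1 (bodyTime-mono (counterBound (L φ)) (m≤L φ) (l≤L φ))))
    (totalTime≤ (L φ)))
  where
  open Reduction φ using (m; l; G)
  n≤ : 4 + (m * 4 + l) ≤ counterBound (L φ)
  n≤ = ≤-trans (+-monoʳ-≤ 4 (+-mono-≤ (*-monoˡ-≤ 4 (m≤L φ)) (l≤L φ))) (≤-reflexive (eq (L φ)))
    where
    eq : ∀ L → 4 + (L * 4 + L) ≡ L * 5 + 4
    eq = solve-∀
  m≤ : m ≤ counterBound (L φ)
  m≤ = ≤-trans (m≤L φ) (≤-trans (m≤m*n (L φ) 5) (m≤m+n _ 4))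
  main = execute (⊢body φ m≤ n≤) []
  end : Vec Tape 3
  end = inputAt (proj₁ main) (false ∷ []) ∷
        move right (outputOf (encodeGraph G)) ∷ counterOf (n G) ∷ []
  whole : Runs reductionProgram
    (inputAt [] (encodeFormula φ) ∷ blankTape ∷ blankTape ∷ [])
    (2 + (bodyTime (counterBound (L φ)) m l + 1)) end
  whole = runs-⨾ (runs-⨾ (runs-instr _ _) (runs-instr _ _)) (runs-⨾ (proj₂ main) (runs-instr _ _))
  t = proj₁ whole
  t≤ = proj₁ (proj₂ whole)
  reach = proj₂ (proj₂ whole)

theorem5p1 : NPHard (BipartiteReinforcement 1)
theorem5p1 = record
  { transform = λ φ → Reduction.G φ , Reduction.bipartite φ
  ; correct   = Reduction.reduction-correct
  ; polyTime  = record
    { machine  = compile reductionProgram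
    ; a        = 876
    ; d        = 2
    ; computes = reduction-computes
    }
  }
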